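{- Let $k\ge 2$ be an integer. If a graph $H$ has Sidorenko's property, then the Cartesian product $H\,\square\, C_{2k}$ also has Sidorenko's property.
   Context: All graphs are finite and simple. $\mathrm{Hom}(H,G)$ is the set of graph homomorphisms from $H$ to $G$. A graph $H$ has Sidorenko's property if for every graph $G$, $|\mathrm{Hom}(H,G)|\ge |V(G)|^{|V(H)|}\left(\frac{2|E(G)|}{|V(G)|^2}\right)^{|E(H)|}$. $C_{2k}$ is the cycle of length $2k$. The Cartesian product $H_1\,\square\,H_2$ has vertex set $V(H_1)\times V(H_2)$, with $(x_1,x_2)$ and $(y_1,y_2)$ adjacent iff either $x_1y_1\in E(H_1)$ and $x_2=y_2$, or $x_2y_2\in E(H_2)$ and $x_1=y_1$. -}

module Defs where

open import Data.Nat using (ℕ; zero; suc; _+_; _*_; _^_; _≤_; _%_)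
open import Data.Bool using (Bool; true; false; _∧_; _∨_)
open import Data.Fin using (Fin; toℕ; remQuot; _≟_)
open import Data.Fin.Properties using (all?)
open import Data.Product using (_×_; _,_)
open import Data.List using (List; []; _∷_; length; filter; concatMap; map; allFin)
open import Data.Vec.Functional using (Vector) renaming (_∷_ to _∷ᵥ_)
import Data.Nat as ℕ
open import Relation.Binary.PropositionalEquality using (_≡_)
open import Relation.Nullary using (Dec; yes; no)
open import Relation.Nullary.Decidable using (⌊_⌋; _→-dec_)
open import Data.Bool.Properties using (∨-comm; ∨-identityʳ) renaming (_≟_ to _≟ᵇ_)
open import Data.Nat.Properties using (≤-trans; <-≤-trans; 1+n≢n; 0≢1+n; m≤n⇒m<n∨m≡n; ≤-refl)
open import Data.Nat.DivMod using (m<n⇒m%n≡m; n%n≡0)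
open import Data.Fin.Properties using (toℕ<n) renaming (_≟_ to _≟ᶠ_)
open import Data.Sum using (inj₁; inj₂)
open import Relation.Binary.PropositionalEquality using (refl; cong; trans; subst)
open import Relation.Nullary.Decidable using (dec-false; does)
open import Data.Empty using (⊥-elim)

record Graph : Set where
  field
    n     : ℕ
    adj   : Fin n → Fin n → Bool
    sym   : ∀ i j → adj i j ≡ adj j i
    irrefl : ∀ i → adj i i ≡ false
open Graph public

∣V∣ : Graph → ℕ
∣V∣ = Graph.n

∣E∣ : Graph → ℕ
∣E∣ G = length (filter (λ p → adjDec p) (allPairs))
  where
  allPairs : List (Fin (n G) × Fin (n G))
  allPairs = concatMap (λ i → map (λ j → (i , j)) (allFin (n G))) (allFin (n G))
  adjDec : (p : Fin (n G) × Fin (n G)) → Dec (((toℕ (Data.Product.proj₁ p) ℕ.< toℕ (Data.Product.proj₂ p)) Data.Product.× (adj G (Data.Product.proj₁ p) (Data.Product.proj₂ p) ≡ true)))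
  adjDec (i , j) = Relation.Nullary.Decidable._×-dec_ (toℕ i ℕ.<? toℕ j) (adj G i j ≟ᵇ true)

IsHom : (H G : Graph) → (Fin (n H) → Fin (n G)) → Set
IsHom H G f = ∀ i j → adj H i j ≡ true → adj G (f i) (f j) ≡ true

isHom? : (H G : Graph) → (f : Fin (n H) → Fin (n G)) → Dec (IsHom H G f)
isHom? H G f = all? λ i → all? λ j → (adj H i j ≟ᵇ true) →-dec (adj G (f i) (f j) ≟ᵇ true)

allFuns : (v m : ℕ) → List (Fin v → Fin m)
allFuns zero    m = (λ ()) ∷ []
allFuns (suc v) m = concatMap (λ f → map (λ x → x ∷ᵥ f) (allFin m)) (allFuns v m)

homCount : Graph → Graph → ℕ
homCount H G = length (filter (isHom? H G) (allFuns (n H) (n G)))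

-- Sidorenko's property, with denominators cleared:
--   |Hom(H,G)| ≥ |V(G)|^|V(H)| (2|E(G)|/|V(G)|²)^|E(H)|
-- ⇔ |Hom(H,G)| · |V(G)|^(2|E(H)|) ≥ |V(G)|^|V(H)| · (2|E(G)|)^|E(H)|
-- for every graph G with at least one vertex.
Sidorenko : Graph → Set
Sidorenko H = ∀ (G : Graph) → 1 ≤ ∣V∣ G →
  ∣V∣ G ^ ∣V∣ H * (2 * ∣E∣ G) ^ ∣E∣ H ≤ homCount H G * ∣V∣ G ^ (2 * ∣E∣ H)

module _ (m : ℕ) (3≤m : 3 ≤ m) where
  private
    instance
      nz : ℕ.NonZero m
      nz = ℕ.>-nonZero (≤-trans (ℕ.s≤s ℕ.z≤n) 3≤m)

  cycleAdj : Fin m → Fin m → Bool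
  cycleAdj i j = does ((suc (toℕ i) % m) ℕ.≟ toℕ j) ∨ does ((suc (toℕ j) % m) ℕ.≟ toℕ i)

  private
    noLoop : ∀ (i : Fin m) → (suc (toℕ i) % m) ≡ toℕ i → Data.Empty.⊥
    noLoop i eq with m≤n⇒m<n∨m≡n (toℕ<n i)
    ... | inj₁ lt = 1+n≢n (trans (Relation.Binary.PropositionalEquality.sym (m<n⇒m%n≡m lt)) eq)
    ... | inj₂ e with toℕ i | eq
    ... | zero | eq' = 3≰1 (subst (3 ≤_) (Relation.Binary.PropositionalEquality.sym e) 3≤m)
      where
      3≰1 : 3 ≤ 1 → Data.Empty.⊥
      3≰1 (ℕ.s≤s ())
    ... | suc t | eq' = 0≢1+n (trans (Relation.Binary.PropositionalEquality.sym (n%n≡0 m)) (trans (cong (_% m) (Relation.Binary.PropositionalEquality.sym e)) eq'))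

  cycleGraph : Graph
  cycleGraph = record
    { n = m
    ; adj = cycleAdj
    ; sym = λ i j → ∨-comm (does ((suc (toℕ i) % m) ℕ.≟ toℕ j)) _
    ; irrefl = λ i → trans (cong (λ b → b ∨ b) (dec-false ((suc (toℕ i) % m) ℕ.≟ toℕ i) (noLoop i))) refl
    }

C[2*_] : (k : ℕ) → 2 ≤ k → Graph
C[2* k ] 2≤k = cycleGraph (2 * k) (≤-trans (ℕ.s≤s (ℕ.s≤s (ℕ.s≤s ℕ.z≤n))) (2≤k⇒4≤2k k 2≤k))
  where
  2≤k⇒4≤2k : ∀ k → 2 ≤ k → 4 ≤ 2 * k
  2≤k⇒4≤2k k le = Data.Nat.Properties.*-monoʳ-≤ 2 le

private
  does-sym : ∀ {a} (x y : Fin a) → does (x ≟ᶠ y) ≡ does (y ≟ᶠ x)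
  does-sym x y with x ≟ᶠ y | y ≟ᶠ x
  ... | yes _ | yes _ = refl
  ... | no _  | no _  = refl
  ... | yes p | no ¬q = ⊥-elim (¬q (Relation.Binary.PropositionalEquality.sym p))
  ... | no ¬p | yes q = ⊥-elim (¬p (Relation.Binary.PropositionalEquality.sym q))

_□_ : Graph → Graph → Graph
H □ K = record { n = n H * n K ; adj = pAdj ; sym = pSym ; irrefl = pIrr }
  where
  pAdj' : Fin (n H) × Fin (n K) → Fin (n H) × Fin (n K) → Bool
  pAdj' (x₁ , x₂) (y₁ , y₂) = (adj H x₁ y₁ ∧ does (x₂ ≟ᶠ y₂)) ∨ (adj K x₂ y₂ ∧ does (x₁ ≟ᶠ y₁))
  pAdj : Fin (n H * n K) → Fin (n H * n K) → Bool
  pAdj u v = pAdj' (remQuot (n K) u) (remQuot (n K) v)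
  pSym' : ∀ p q → pAdj' p q ≡ pAdj' q p
  pSym' (x₁ , x₂) (y₁ , y₂) rewrite Graph.sym H x₁ y₁ | Graph.sym K x₂ y₂ | does-sym x₁ y₁ | does-sym x₂ y₂ = refl
  pSym : ∀ u v → pAdj u v ≡ pAdj v u
  pSym u v = pSym' (remQuot (n K) u) (remQuot (n K) v)
  pIrr' : ∀ p → pAdj' p p ≡ false
  pIrr' (x₁ , x₂) rewrite Graph.irrefl H x₁ | Graph.irrefl K x₂ = refl
  pIrr : ∀ u → pAdj u u ≡ false
  pIrr u = pIrr' (remQuot (n K) u)

{-# OPTIONS --safe #-}

-- Let A be the transfer matrix on Hom(H, G), so that tr A^{2k} counts Hom(H □ C_{2k}, G). By Cauchy–Schwarz
-- tr A^{2ks} ≤ (tr A^{2k})^s for s a power of two, hence it suffices to bound Hom(H □ P_m, G) from below for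
-- long paths P_m, up to a factor that is subexponential in m. Such homomorphisms are the homomorphisms
-- from H into the graph of walks of length m in G, to which Sidorenko's property of H is applied. The
-- bound is the right one when G is nearly regular. In general G is replaced by a tensor power: its degrees
-- fall into polynomially many dyadic classes, so it contains a nearly regular induced subgraph which keeps all
-- but a polynomial fraction of the edges, and that fraction disappears after taking roots.
module Submission where

open import Defs
open import Data.Nat using (ℕ; _≤_)
open import Data.Bool using (Bool; true; false; _∧_; _∨_)
open import Data.Bool.Properties using () renaming (_≟_ to _≟ᵇ_)
open import Data.Empty using (⊥; ⊥-elim)
open import Data.Fin as Fin using (Fin; zero; suc; toℕ; fromℕ<; combine; remQuot; _↑ˡ_; _↑ʳ_)
open import Data.Fin.Properties using (toℕ-injective; toℕ-fromℕ<; toℕ<n; remQuot-combine; combine-remQuot) renaming (_≟_ to _≟ᶠ_)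
open import Data.List using (List; []; _∷_; _++_; map; concatMap; allFin; filter; length; upTo; cartesianProduct)
import Data.List.Properties as List
open import Data.List.Membership.Propositional using (_∈_)
open import Data.List.Membership.Propositional.Properties using (∈-filter⁺; ∈-filter⁻; ∈-upTo⁺; ∈-concatMap⁺; ∈-map⁺; ∈-allFin)
open import Data.List.Relation.Unary.Any as Any using (here; there)
open import Data.Nat using (zero; suc; z≤n; s≤s; _+_; _*_; _∸_; _^_; _<_; _%_; NonZero; >-nonZero)
open import Data.Nat.DivMod using (m<n⇒m%n≡m; n%n≡0; m%n<n)
open import Data.Nat.Properties
open import Data.Nat.Tactic.RingSolver using (solve-∀)
open import Data.Product using (_×_; _,_; proj₁; proj₂; ∃)
open import Data.Sum using (_⊎_; inj₁; inj₂)
open import Data.Vec as Vec using (Vec; []; _∷_; lookup; zipWith; head; replicate; concat; _∷ʳ_)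
open import Data.Vec.Properties using (lookup-zipWith; lookup-map; lookup-concat; lookup∘tabulate)
open import Function using (_∘_; id; case_of_)
open import Relation.Binary.Definitions using (tri<; tri≈; tri>)
open import Relation.Binary.PropositionalEquality as ≡ using (_≡_; refl; cong; cong₂; trans; subst; module ≡-Reasoning)
open import Relation.Nullary using (Dec; yes; no; ¬_; does)
open import Relation.Nullary.Decidable using (_×-dec_; dec-true)

-- For the graph of walks with m edges, Sidorenko's property reads t₁^v t₂^e ≤ t t₁^(2e), where t₁,
-- t₂ and t count the homomorphisms from P_m, K₂ □ P_m and H □ P_m, and v, e are the numbers of
-- vertices and edges of H. Lower bounds for t₁ and t₂ at even m come from log-convexity: t₁ ≥ N
-- (M/N)^m and t₂ ≥ M (c/M)^m, with N vertices, M = 2|E| and c ≥ M⁴/N⁴ homomorphisms from C₄. But t₁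
-- also stands on the right, where it must be bounded above by N Δ^m, and this has the right order
-- only if the maximal degree Δ is about M/N. Hence the detour through nearly regular graphs.
--
-- The edges between dyadic classes i and j join vertices whose degrees may be far apart. Pairs (x,
-- y) with x in class i and y in class j, however, all have degree about 2^(i+j) in the tensor
-- square, and so do pairs of classes (j, i). The subgraph is therefore chosen in a tensor square.
--
-- There are two separate limits: the number of rungs grows with the subgraph fixed, then the tensor
-- power grows. Everything stays in ℕ: denominators are cleared, and roots are compared along
-- exponents 2^j.

private variable
  A B C : Set

-- Finite sums

∑ : List A → (A → ℕ) → ℕ
∑ []       f = 0
∑ (x ∷ xs) f = f x + ∑ xs f

∑-cong : ∀ (xs : List A) {f g : A → ℕ} → (∀ x → f x ≡ g x) → ∑ xs f ≡ ∑ xs g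
∑-cong []       eq = refl
∑-cong (x ∷ xs) eq = cong₂ _+_ (eq x) (∑-cong xs eq)

∑-mono : ∀ (xs : List A) {f g : A → ℕ} → (∀ x → f x ≤ g x) → ∑ xs f ≤ ∑ xs g
∑-mono []       le = z≤n
∑-mono (x ∷ xs) le = +-mono-≤ (le x) (∑-mono xs le)

∑-0 : ∀ (xs : List A) → ∑ xs (λ _ → 0) ≡ 0
∑-0 []       = refl
∑-0 (x ∷ xs) = ∑-0 xs

+-interchange : ∀ a b c d → (a + b) + (c + d) ≡ (a + c) + (b + d)
+-interchange = solve-∀

∑-+ : ∀ (xs : List A) {f g : A → ℕ} → ∑ xs (λ x → f x + g x) ≡ ∑ xs f + ∑ xs g
∑-+ []       = refl
∑-+ (x ∷ xs) {f} {g} = trans (cong (f x + g x +_) (∑-+ xs)) (+-interchange (f x) (g x) _ _)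

∑-*ˡ : ∀ (xs : List A) c {f : A → ℕ} → ∑ xs (λ x → c * f x) ≡ c * ∑ xs f
∑-*ˡ []       c = ≡.sym (*-zeroʳ c)
∑-*ˡ (x ∷ xs) c {f} = trans (cong (c * f x +_) (∑-*ˡ xs c)) (≡.sym (*-distribˡ-+ c _ _))

∑-*ʳ : ∀ (xs : List A) c {f : A → ℕ} → ∑ xs (λ x → f x * c) ≡ ∑ xs f * c
∑-*ʳ xs c {f} = trans (∑-cong xs (λ x → *-comm (f x) c)) (trans (∑-*ˡ xs c) (*-comm c _))

∑-swap : ∀ (xs : List A) (ys : List B) {f : A → B → ℕ} →
  ∑ xs (λ x → ∑ ys (f x)) ≡ ∑ ys (λ y → ∑ xs (λ x → f x y))
∑-swap []       ys = ≡.sym (∑-0 ys)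
∑-swap (x ∷ xs) ys {f} = trans (cong (∑ ys (f x) +_) (∑-swap xs ys)) (≡.sym (∑-+ ys))

∑-* : ∀ (xs : List A) (ys : List B) {f : A → ℕ} {g : B → ℕ} →
  ∑ xs (λ x → ∑ ys (λ y → f x * g y)) ≡ ∑ xs f * ∑ ys g
∑-* xs ys {f} {g} = trans (∑-cong xs (λ x → ∑-*ˡ ys (f x))) (∑-*ʳ xs _)

∑-++ : ∀ (xs ys : List A) {f : A → ℕ} → ∑ (xs ++ ys) f ≡ ∑ xs f + ∑ ys f
∑-++ []       ys = refl
∑-++ (x ∷ xs) ys {f} = trans (cong (f x +_) (∑-++ xs ys)) (≡.sym (+-assoc (f x) _ _))

∑-map : ∀ (g : A → B) (xs : List A) {f : B → ℕ} → ∑ (map g xs) f ≡ ∑ xs (f ∘ g)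
∑-map g []       = refl
∑-map g (x ∷ xs) {f} = cong (f (g x) +_) (∑-map g xs)

∑-concatMap : ∀ (g : A → List B) (xs : List A) {f : B → ℕ} →
  ∑ (concatMap g xs) f ≡ ∑ xs (λ x → ∑ (g x) f)
∑-concatMap g []       = refl
∑-concatMap g (x ∷ xs) {f} =
  trans (∑-++ (g x) (concatMap g xs)) (cong (∑ (g x) f +_) (∑-concatMap g xs))

∑-concatMap-map : ∀ (g : A → B → C) (xs : List A) (ys : List B) {f : C → ℕ} →
  ∑ (concatMap (λ x → map (g x) ys) xs) f ≡ ∑ xs (λ x → ∑ ys (λ y → f (g x y)))
∑-concatMap-map g xs ys = trans (∑-concatMap _ xs) (∑-cong xs (λ x → ∑-map (g x) ys))

∑-const : ∀ (xs : List A) c → ∑ xs (λ _ → c) ≡ length xs * c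
∑-const []       c = refl
∑-const (x ∷ xs) c = cong (c +_) (∑-const xs c)

[[_]] : ∀ {P : Set} → Dec P → ℕ
[[ yes _ ]] = 1
[[ no  _ ]] = 0

[[_]]-yes : ∀ {P : Set} (d : Dec P) → P → [[ d ]] ≡ 1
[[ yes _ ]]-yes p = refl
[[ no ¬p ]]-yes p = ⊥-elim (¬p p)

[[_]]-no : ∀ {P : Set} (d : Dec P) → ¬ P → [[ d ]] ≡ 0
[[ yes p ]]-no ¬p = ⊥-elim (¬p p)
[[ no _  ]]-no ¬p = refl

[[]]≤1 : ∀ {P : Set} (d : Dec P) → [[ d ]] ≤ 1
[[]]≤1 (yes _) = ≤-refl
[[]]≤1 (no _)  = z≤n

[[]]-cong : ∀ {P Q : Set} (d : Dec P) (d′ : Dec Q) → (P → Q) → (Q → P) → [[ d ]] ≡ [[ d′ ]]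
[[]]-cong (yes p) (yes q) f g = refl
[[]]-cong (yes p) (no ¬q) f g = ⊥-elim (¬q (f p))
[[]]-cong (no ¬p) (yes q) f g = ⊥-elim (¬p (g q))
[[]]-cong (no ¬p) (no ¬q) f g = refl

∑-filter : ∀ {P : A → Set} (P? : ∀ x → Dec (P x)) (xs : List A) {f : A → ℕ} →
  ∑ (filter P? xs) f ≡ ∑ xs (λ x → [[ P? x ]] * f x)
∑-filter P? []       = refl
∑-filter P? (x ∷ xs) {f} with P? x
... | yes _ = cong₂ _+_ (≡.sym (+-identityʳ (f x))) (∑-filter P? xs)
... | no  _ = ∑-filter P? xs

length-filter : ∀ {P : A → Set} (P? : ∀ x → Dec (P x)) (xs : List A) →
  length (filter P? xs) ≡ ∑ xs (λ x → [[ P? x ]])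
length-filter P? xs = trans (≡.sym (trans (∑-const (filter P? xs) 1) (*-identityʳ _)))
  (trans (∑-filter P? xs) (∑-cong xs (λ x → *-identityʳ _)))

m²≤n²⇒m≤n : ∀ {m n} → m * m ≤ n * n → m ≤ n
m²≤n²⇒m≤n {m} {n} le with m ≤? n
... | yes p = p
... | no ¬p = ⊥-elim (<⇒≱ (*-mono-< (≰⇒> ¬p) (≰⇒> ¬p)) le)

2mn≤m²+n² : ∀ m n → 2 * (m * n) ≤ m * m + n * n
2mn≤m²+n² m n with ≤-total m n
... | inj₁ m≤n = subst (λ n → 2 * (m * n) ≤ m * m + n * n) (m+[n∸m]≡n m≤n) (lemma m _)
  where
  eq : ∀ a d → a * a + (a + d) * (a + d) ≡ 2 * (a * (a + d)) + d * d
  eq = solve-∀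
  lemma : ∀ a d → 2 * (a * (a + d)) ≤ a * a + (a + d) * (a + d)
  lemma a d = ≤-trans (m≤m+n _ (d * d)) (≤-reflexive (≡.sym (eq a d)))
... | inj₂ n≤m = subst (λ m → 2 * (m * n) ≤ m * m + n * n) (m+[n∸m]≡n n≤m) (lemma n _)
  where
  eq : ∀ a d → (a + d) * (a + d) + a * a ≡ 2 * ((a + d) * a) + d * d
  eq = solve-∀
  lemma : ∀ a d → 2 * ((a + d) * a) ≤ (a + d) * (a + d) + a * a
  lemma a d = ≤-trans (m≤m+n _ (d * d)) (≤-reflexive (≡.sym (eq a d)))

-- Lagrange: twice the square of the left-hand sum is a double sum, estimated termwise by 2ab ≤ a² + b².
cauchy-schwarz : ∀ (xs : List A) (μ u w : A → ℕ) →
  ∑ xs (λ x → μ x * (u x * w x)) * ∑ xs (λ x → μ x * (u x * w x))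
    ≤ ∑ xs (λ x → μ x * (u x * u x)) * ∑ xs (λ x → μ x * (w x * w x))
cauchy-schwarz xs μ u w = *-cancelˡ-≤ 2 (begin
  2 * (S * S)
    ≡⟨ cong (2 *_) (∑-* xs xs) ⟨
  2 * ∑ xs (λ x → ∑ xs (λ y → (μ x * (u x * w x)) * (μ y * (u y * w y))))
    ≡⟨ ∑-*ˡ xs 2 ⟨
  ∑ xs (λ x → 2 * ∑ xs (λ y → (μ x * (u x * w x)) * (μ y * (u y * w y))))
    ≡⟨ ∑-cong xs (λ x → ∑-*ˡ xs 2) ⟨
  ∑ xs (λ x → ∑ xs (λ y → 2 * ((μ x * (u x * w x)) * (μ y * (u y * w y)))))
    ≤⟨ ∑-mono xs (λ x → ∑-mono xs (λ y → termwise (μ x) (u x) (w x) (μ y) (u y) (w y))) ⟩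
  ∑ xs (λ x → ∑ xs (λ y → (μ x * (u x * u x)) * (μ y * (w y * w y)) + (μ x * (w x * w x)) * (μ y * (u y * u y))))
    ≡⟨ ∑-cong xs (λ x → ∑-+ xs) ⟩
  ∑ xs (λ x → ∑ xs (λ y → (μ x * (u x * u x)) * (μ y * (w y * w y))) + ∑ xs (λ y → (μ x * (w x * w x)) * (μ y * (u y * u y))))
    ≡⟨ ∑-+ xs ⟩
  ∑ xs (λ x → ∑ xs (λ y → (μ x * (u x * u x)) * (μ y * (w y * w y)))) + ∑ xs (λ x → ∑ xs (λ y → (μ x * (w x * w x)) * (μ y * (u y * u y))))
    ≡⟨ cong₂ _+_ (∑-* xs xs) (∑-* xs xs) ⟩
  U * W + W * U
    ≡⟨ cong (U * W +_) (trans (*-comm W U) (≡.sym (+-identityʳ _))) ⟩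
  2 * (U * W) ∎)
  where
  open ≤-Reasoning
  S = ∑ xs (λ x → μ x * (u x * w x))
  U = ∑ xs (λ x → μ x * (u x * u x))
  W = ∑ xs (λ x → μ x * (w x * w x))
  lhs : ∀ m a b n c d → 2 * ((m * (a * b)) * (n * (c * d))) ≡ (m * n) * (2 * ((a * d) * (b * c)))
  lhs = solve-∀
  rhs : ∀ m a b n c d → (m * n) * ((a * d) * (a * d) + (b * c) * (b * c))
      ≡ (m * (a * a)) * (n * (d * d)) + (m * (b * b)) * (n * (c * c))
  rhs = solve-∀
  termwise : ∀ m a b n c d → 2 * ((m * (a * b)) * (n * (c * d))) ≤
    (m * (a * a)) * (n * (d * d)) + (m * (b * b)) * (n * (c * c))
  termwise m a b n c d = ≤-trans (≤-reflexive (lhs m a b n c d))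
    (≤-trans (*-monoʳ-≤ (m * n) (2mn≤m²+n² (a * d) (b * c))) (≤-reflexive (rhs m a b n c d)))

∑-pigeonhole : ∀ (xs : List A) (f : A → ℕ) → 1 ≤ length xs → ∃ λ x → ∑ xs f ≤ length xs * f x
∑-pigeonhole (x ∷ [])     f _ = x , ≤-refl
∑-pigeonhole (x ∷ y ∷ ys) f _ with ∑-pigeonhole (y ∷ ys) f (s≤s z≤n)
... | z , le with ≤-total (f x) (f z)
... | inj₁ x≤z = z , +-mono-≤ x≤z le
... | inj₂ z≤x = x , +-monoʳ-≤ (f x) (≤-trans le (*-monoʳ-≤ (length (y ∷ ys)) z≤x))

vecs : ∀ v → List A → List (Vec A v)
vecs zero    xs = [] ∷ []
vecs (suc v) xs = concatMap (λ x → map (x ∷_) (vecs v xs)) xs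

∑-vecs-suc : ∀ v (xs : List A) {φ : Vec A (suc v) → ℕ} →
  ∑ (vecs (suc v) xs) φ ≡ ∑ xs (λ x → ∑ (vecs v xs) (λ h → φ (x ∷ h)))
∑-vecs-suc v xs = ∑-concatMap-map _∷_ xs (vecs v xs)

∑-vecs-map : ∀ v (c : A → B) (xs : List A) (zs : List B) →
  (∀ φ → ∑ zs φ ≡ ∑ xs (φ ∘ c)) →
  ∀ {φ} → ∑ (vecs v zs) φ ≡ ∑ (vecs v xs) (φ ∘ Vec.map c)
∑-vecs-map zero    c xs zs eq = refl
∑-vecs-map (suc v) c xs zs eq {φ} = begin
  ∑ (vecs (suc v) zs) φ                                        ≡⟨ ∑-vecs-suc v zs ⟩
  ∑ zs (λ z → ∑ (vecs v zs) (λ h → φ (z ∷ h)))                 ≡⟨ eq _ ⟩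
  ∑ xs (λ x → ∑ (vecs v zs) (λ h → φ (c x ∷ h)))               ≡⟨ ∑-cong xs (λ x → ∑-vecs-map v c xs zs eq) ⟩
  ∑ xs (λ x → ∑ (vecs v xs) (λ h → φ (c x ∷ Vec.map c h)))     ≡⟨ ∑-vecs-suc v xs ⟨
  ∑ (vecs (suc v) xs) (φ ∘ Vec.map c)                          ∎
  where open ≡-Reasoning

-- The hypothesis says that `zs` lists the values of `c` with multiplicity. It is phrased through
-- test functions `φ`, so that the order of the lists never matters. The combiner `c` will be `_,_`
-- for tensor products and `_∷_` for walks and for transposing.
∑-vecs-zipWith : ∀ v (c : A → B → C) (xs : List A) (ys : List B) (zs : List C) →
  (∀ φ → ∑ zs φ ≡ ∑ xs (λ x → ∑ ys (λ y → φ (c x y)))) →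
  ∀ {φ} → ∑ (vecs v zs) φ ≡ ∑ (vecs v xs) (λ f → ∑ (vecs v ys) (λ g → φ (zipWith c f g)))
∑-vecs-zipWith zero    c xs ys zs eq {φ} = ≡.sym (+-identityʳ (φ [] + 0))
∑-vecs-zipWith (suc v) c xs ys zs eq {φ} = begin
  ∑ (vecs (suc v) zs) φ
    ≡⟨ ∑-vecs-suc v zs ⟩
  ∑ zs (λ z → ∑ (vecs v zs) (λ h → φ (z ∷ h)))
    ≡⟨ eq _ ⟩
  ∑ xs (λ x → ∑ ys (λ y → ∑ (vecs v zs) (λ h → φ (c x y ∷ h))))
    ≡⟨ ∑-cong xs (λ x → ∑-cong ys (λ y → ∑-vecs-zipWith v c xs ys zs eq)) ⟩
  ∑ xs (λ x → ∑ ys (λ y → ∑ (vecs v xs) (λ f → ∑ (vecs v ys) (λ g → φ (c x y ∷ zipWith c f g)))))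
    ≡⟨ ∑-cong xs (λ x → ∑-swap ys (vecs v xs)) ⟩
  ∑ xs (λ x → ∑ (vecs v xs) (λ f → ∑ ys (λ y → ∑ (vecs v ys) (λ g → φ (c x y ∷ zipWith c f g)))))
    ≡⟨ ∑-cong xs (λ x → ∑-cong (vecs v xs) (λ f → ∑-vecs-suc v ys)) ⟨
  ∑ xs (λ x → ∑ (vecs v xs) (λ f → ∑ (vecs (suc v) ys) (λ g → φ (zipWith c (x ∷ f) g))))
    ≡⟨ ∑-vecs-suc v xs ⟨
  ∑ (vecs (suc v) xs) (λ f → ∑ (vecs (suc v) ys) (λ g → φ (zipWith c f g))) ∎
  where open ≡-Reasoning

∏ : ∀ {v} → (A → ℕ) → Vec A v → ℕ
∏ μ []      = 1
∏ μ (x ∷ h) = μ x * ∏ μ h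

*-interchange : ∀ a b c d → (a * b) * (c * d) ≡ (a * c) * (b * d)
*-interchange = solve-∀

∑-vecs-filter : ∀ v {P : A → Set} (P? : ∀ x → Dec (P x)) (xs : List A) {φ : Vec A v → ℕ} →
  ∑ (vecs v (filter P? xs)) φ ≡ ∑ (vecs v xs) (λ h → ∏ (λ x → [[ P? x ]]) h * φ h)
∑-vecs-filter zero    P? xs {φ} = cong (_+ 0) (≡.sym (+-identityʳ (φ [])))
∑-vecs-filter (suc v) P? xs {φ} = begin
  ∑ (vecs (suc v) (filter P? xs)) φ
    ≡⟨ ∑-vecs-suc v (filter P? xs) ⟩
  ∑ (filter P? xs) (λ x → ∑ (vecs v (filter P? xs)) (λ h → φ (x ∷ h)))
    ≡⟨ ∑-filter P? xs ⟩
  ∑ xs (λ x → [[ P? x ]] * ∑ (vecs v (filter P? xs)) (λ h → φ (x ∷ h)))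
    ≡⟨ ∑-cong xs (λ x → cong ([[ P? x ]] *_) (∑-vecs-filter v P? xs)) ⟩
  ∑ xs (λ x → [[ P? x ]] * ∑ (vecs v xs) (λ h → ∏ ι h * φ (x ∷ h)))
    ≡⟨ ∑-cong xs (λ x → trans (≡.sym (∑-*ˡ (vecs v xs) [[ P? x ]]))
         (∑-cong (vecs v xs) (λ h → ≡.sym (*-assoc [[ P? x ]] (∏ ι h) (φ (x ∷ h)))))) ⟩
  ∑ xs (λ x → ∑ (vecs v xs) (λ h → ∏ ι (x ∷ h) * φ (x ∷ h)))
    ≡⟨ ∑-vecs-suc v xs ⟨
  ∑ (vecs (suc v) xs) (λ h → ∏ ι h * φ h) ∎
  where
  open ≡-Reasoning
  ι = λ x → [[ P? x ]]

-- xs ≼ ys : xs is contained in ys as a multiset.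
_≼_ : List A → List A → Set
xs ≼ ys = ∀ φ → ∑ xs φ ≤ ∑ ys φ

filter-≼ : ∀ {P : A → Set} (P? : ∀ x → Dec (P x)) (xs : List A) → filter P? xs ≼ xs
filter-≼ P? xs φ = ≤-trans (≤-reflexive (∑-filter P? xs))
  (∑-mono xs (λ x → ≤-trans (*-monoˡ-≤ (φ x) ([[]]≤1 (P? x))) (≤-reflexive (+-identityʳ _))))

vecs-≼ : ∀ v {xs ys : List A} → xs ≼ ys → vecs v xs ≼ vecs v ys
vecs-≼ zero    le φ = ≤-refl
vecs-≼ (suc v) {xs} {ys} le φ = ≤-trans (≤-reflexive (∑-vecs-suc v xs))
  (≤-trans (le _) (≤-trans (∑-mono ys (λ y → vecs-≼ v le _)) (≤-reflexive (≡.sym (∑-vecs-suc v ys)))))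

-- For a 0/1-valued `r` this is the indicator that `f` maps every edge in `es` to a related pair,
-- hence the weight of `f` as a homomorphism.
E : ∀ {v} → List (Fin v × Fin v) → (A → A → ℕ) → Vec A v → ℕ
E []             r f = 1
E ((a , b) ∷ es) r f = r (lookup f a) (lookup f b) * E es r f

-- For a 0/1-valued `r`, the entry of the transfer matrix: it is 1 when the copies `f` and `g` of H
-- can stand on neighbouring vertices of the path or cycle.
cross : ∀ {v} → (A → A → ℕ) → Vec A v → Vec A v → ℕ
cross r []      []      = 1
cross r (x ∷ f) (y ∷ g) = r x y * cross r f g

cross-sym : ∀ {v} (r : A → A → ℕ) → (∀ x y → r x y ≡ r y x) → (f g : Vec A v) → cross r f g ≡ cross r g f
cross-sym r r-sym []      []      = refl
cross-sym r r-sym (x ∷ f) (y ∷ g) = cong₂ _*_ (r-sym x y) (cross-sym r r-sym f g)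

module _ (c : A → B → C) (r : A → A → ℕ) (s : B → B → ℕ) (t : C → C → ℕ)
         (t≡rs : ∀ x x′ y y′ → t (c x y) (c x′ y′) ≡ r x x′ * s y y′) where

  -- A compound vertex is a pair in a tensor product, or a walk prolonged by one vertex; in both
  -- cases adjacency is a product of adjacencies, so the weights multiply edge by edge.
  E-zipWith : ∀ {v} (es : List (Fin v × Fin v)) f g → E es t (zipWith c f g) ≡ E es r f * E es s g
  E-zipWith []             f g = refl
  E-zipWith ((a , b) ∷ es) f g = begin
    t (lookup (zipWith c f g) a) (lookup (zipWith c f g) b) * E es t (zipWith c f g)
      ≡⟨ cong₂ (λ z z′ → t z z′ * E es t (zipWith c f g)) (lookup-zipWith c a f g) (lookup-zipWith c b f g) ⟩
    t (c (lookup f a) (lookup g a)) (c (lookup f b) (lookup g b)) * E es t (zipWith c f g)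
      ≡⟨ cong₂ _*_ (t≡rs _ _ _ _) (E-zipWith es f g) ⟩
    (r (lookup f a) (lookup f b) * s (lookup g a) (lookup g b)) * (E es r f * E es s g)
      ≡⟨ *-interchange (r (lookup f a) (lookup f b)) _ _ _ ⟩
    E ((a , b) ∷ es) r f * E ((a , b) ∷ es) s g ∎
    where open ≡-Reasoning

  cross-zipWith : ∀ {v} (f f′ : Vec A v) (g g′ : Vec B v) →
    cross t (zipWith c f g) (zipWith c f′ g′) ≡ cross r f f′ * cross s g g′
  cross-zipWith []      []        []      []        = refl
  cross-zipWith (x ∷ f) (x′ ∷ f′) (y ∷ g) (y′ ∷ g′) =
    trans (cong₂ _*_ (t≡rs x x′ y y′) (cross-zipWith f f′ g g′)) (*-interchange (r x x′) (s y y′) _ _)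

-- Walks of a weighted kernel

∑-cartesianProduct : ∀ (xs : List A) (ys : List B) {φ : A × B → ℕ} →
  ∑ (cartesianProduct xs ys) φ ≡ ∑ xs (λ x → ∑ ys (λ y → φ (x , y)))
∑-cartesianProduct []       ys = refl
∑-cartesianProduct (x ∷ xs) ys =
  trans (∑-++ (map (x ,_) ys) _) (cong₂ _+_ (∑-map (x ,_) ys) (∑-cartesianProduct xs ys))

length-cartesianProduct : ∀ (xs : List A) (ys : List B) →
  length (cartesianProduct xs ys) ≡ length xs * length ys
length-cartesianProduct []       ys = refl
length-cartesianProduct (x ∷ xs) ys = trans (List.length-++ (map (x ,_) ys))
  (cong₂ _+_ (List.length-map (x ,_) ys) (length-cartesianProduct xs ys))

^-distribʳ-* : ∀ m n o → (m * n) ^ o ≡ m ^ o * n ^ o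
^-distribʳ-* m n zero    = refl
^-distribʳ-* m n (suc o) = trans (cong (m * n *_) (^-distribʳ-* m n o)) (*-interchange m n _ _)

-- In the application `X` consists of the maps from V(H) to V(G), `μ` is the indicator of
-- homomorphisms and `K` is `cross`. Then `T m` counts homomorphisms from H □ P_m, and `tr` of a
-- composite of `K` counts those from H times a closed walk.
module Kernel (X : Set) (xs : List X) (μ : X → ℕ) (K : X → X → ℕ) where

  Op : (X → X → ℕ) → (X → ℕ) → X → ℕ
  Op R u f = ∑ xs (λ g → μ g * (R f g * u g))

  walksFrom : ℕ → X → ℕ
  walksFrom zero    f = 1
  walksFrom (suc m) f = Op K (walksFrom m) f

  T : ℕ → ℕ
  T m = ∑ xs (λ f → μ f * walksFrom m f)

  Symmetric : (X → X → ℕ) → Set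
  Symmetric R = ∀ f g → R f g ≡ R g f

  Op-cong : ∀ R {u w : X → ℕ} → (∀ f → u f ≡ w f) → ∀ f → Op R u f ≡ Op R w f
  Op-cong R eq f = ∑-cong xs (λ g → cong (λ z → μ g * (R f g * z)) (eq g))

  Op-adjoint : ∀ R → Symmetric R → ∀ u w →
    ∑ xs (λ f → μ f * (Op R u f * w f)) ≡ ∑ xs (λ f → μ f * (u f * Op R w f))
  Op-adjoint R R-sym u w = begin
    ∑ xs (λ f → μ f * (Op R u f * w f))
      ≡⟨ ∑-cong xs (λ f → trans (mid (μ f) (Op R u f) (w f)) (≡.sym (∑-*ʳ xs (μ f * w f)))) ⟩
    ∑ xs (λ f → ∑ xs (λ g → (μ g * (R f g * u g)) * (μ f * w f)))
      ≡⟨ ∑-swap xs xs ⟩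
    ∑ xs (λ g → ∑ xs (λ f → (μ g * (R f g * u g)) * (μ f * w f)))
      ≡⟨ ∑-cong xs (λ g → ∑-cong xs (λ f →
           trans (cong (λ z → (μ g * (z * u g)) * (μ f * w f)) (R-sym f g))
                 (shuffle (μ g) (R g f) (u g) (μ f) (w f)))) ⟩
    ∑ xs (λ g → ∑ xs (λ f → (μ g * u g) * (μ f * (R g f * w f))))
      ≡⟨ ∑-cong xs (λ g → trans (∑-*ˡ xs (μ g * u g)) (*-assoc (μ g) (u g) _)) ⟩
    ∑ xs (λ g → μ g * (u g * Op R w g)) ∎
    where
    open ≡-Reasoning
    mid : ∀ a b c → a * (b * c) ≡ b * (a * c)
    mid = solve-∀
    shuffle : ∀ a b c d e → (a * (b * c)) * (d * e) ≡ (a * c) * (d * (b * e))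
    shuffle = solve-∀

  sq : (X → X → ℕ) → X → X → ℕ
  sq R f g = ∑ xs (λ h → μ h * (R f h * R h g))

  tr : (X → X → ℕ) → ℕ
  tr R = ∑ xs (λ f → μ f * R f f)

  -- path n f g counts the weighted walks from f to g with n + 1 steps.
  path : ℕ → X → X → ℕ
  path zero    f g = K f g
  path (suc n) f g = ∑ xs (λ h → μ h * (K f h * path n h g))

  -- Associativity of the composition of kernels, by exchanging the two sums. Squares, paths and
  -- walk counts are all compared through it.
  swap-factors : ∀ (R S : X → X → ℕ) (u : X → ℕ) f →
    ∑ xs (λ h → μ h * (R f h * ∑ xs (λ g → μ g * (S h g * u g))))
      ≡ ∑ xs (λ g → μ g * (∑ xs (λ h → μ h * (R f h * S h g)) * u g))
  swap-factors R S u f = begin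
    ∑ xs (λ h → μ h * (R f h * ∑ xs (λ g → μ g * (S h g * u g))))
      ≡⟨ ∑-cong xs (λ h → trans (≡.sym (*-assoc (μ h) (R f h) _)) (≡.sym (∑-*ˡ xs (μ h * R f h)))) ⟩
    ∑ xs (λ h → ∑ xs (λ g → (μ h * R f h) * (μ g * (S h g * u g))))
      ≡⟨ ∑-swap xs xs ⟩
    ∑ xs (λ g → ∑ xs (λ h → (μ h * R f h) * (μ g * (S h g * u g))))
      ≡⟨ ∑-cong xs (λ g → ∑-cong xs (λ h → shuffle (μ h) (R f h) (μ g) (S h g) (u g))) ⟩
    ∑ xs (λ g → ∑ xs (λ h → (μ h * (R f h * S h g)) * (μ g * u g)))
      ≡⟨ ∑-cong xs (λ g → trans (∑-*ʳ xs (μ g * u g) {λ h → μ h * (R f h * S h g)}) (mid (∑ xs (λ h → μ h * (R f h * S h g))) (μ g) (u g))) ⟩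
    ∑ xs (λ g → μ g * (∑ xs (λ h → μ h * (R f h * S h g)) * u g)) ∎
    where
    open ≡-Reasoning
    mid : ∀ a b c → a * (b * c) ≡ b * (a * c)
    mid = solve-∀
    shuffle : ∀ a b c d e → (a * b) * (c * (d * e)) ≡ (a * (b * d)) * (c * e)
    shuffle = solve-∀

  Op-sq : ∀ R u f → Op (sq R) u f ≡ Op R (Op R u) f
  Op-sq R u f = ≡.sym (swap-factors R R u f)

  path-compose : ∀ a b f g → path (suc (a + b)) f g ≡ ∑ xs (λ h → μ h * (path a f h * path b h g))
  path-compose zero    b f g = refl
  path-compose (suc a) b f g =
    trans (∑-cong xs (λ h → cong (λ z → μ h * (K f h * z)) (path-compose a b h g)))
          (swap-factors K (path a) (λ h → path b h g) f)

  -- The kernel power of `R` with exponent 2^l, by repeated squaring, because the trace inequality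
  -- below relates a kernel to its square.
  double : (X → X → ℕ) → ℕ → X → X → ℕ
  double R zero    = R
  double R (suc l) = sq (double R l)

  Op-path : ∀ n m f → Op (path n) (walksFrom m) f ≡ walksFrom (suc n + m) f
  Op-path zero    m f = refl
  Op-path (suc n) m f = trans (≡.sym (swap-factors K (path n) (walksFrom m) f))
    (Op-cong K (Op-path n m) f)

  Op-double-path : ∀ n l m f → Op (double (path n) l) (walksFrom m) f ≡ walksFrom (2 ^ l * suc n + m) f
  Op-double-path n zero    m f =
    trans (Op-path n m f) (cong (λ z → walksFrom (z + m) f) (≡.sym (*-identityˡ (suc n))))
  Op-double-path n (suc l) m f = begin
    Op (sq D) (walksFrom m) f           ≡⟨ Op-sq D (walksFrom m) f ⟩
    Op D (Op D (walksFrom m)) f         ≡⟨ Op-cong D (Op-double-path n l m) f ⟩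
    Op D (walksFrom (p + m)) f          ≡⟨ Op-double-path n l (p + m) f ⟩
    walksFrom (p + (p + m)) f           ≡⟨ cong (λ z → walksFrom z f) (two (2 ^ l) (suc n) m) ⟩
    walksFrom (2 ^ suc l * suc n + m) f ∎
    where
    open ≡-Reasoning
    D = double (path n) l
    p = 2 ^ l * suc n
    two : ∀ q s m → q * s + (q * s + m) ≡ (2 * q) * s + m
    two = solve-∀

  -- Inequalities for symmetric kernels

  module Undirected (K-sym : Symmetric K) where

    -- `T (i + j)` is an inner product of two walk functions: self-adjointness moves the steps one
    -- at a time from one factor to the other.
    T-split : ∀ i j → ∑ xs (λ f → μ f * (walksFrom i f * walksFrom j f)) ≡ T (i + j)
    T-split zero    j = ∑-cong xs (λ f → cong (μ f *_) (*-identityˡ _))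
    T-split (suc i) j = trans (Op-adjoint K K-sym (walksFrom i) (walksFrom j))
      (trans (T-split i (suc j)) (cong T (+-suc i j)))

    T-cauchy-schwarz : ∀ i j → T (i + j) * T (i + j) ≤ T (i + i) * T (j + j)
    T-cauchy-schwarz i j = begin
      T (i + j) * T (i + j) ≡⟨ cong₂ _*_ (T-split i j) (T-split i j) ⟨
      _                     ≤⟨ cauchy-schwarz xs μ (walksFrom i) (walksFrom j) ⟩
      _                     ≡⟨ cong₂ _*_ (T-split i i) (T-split j j) ⟩
      T (i + i) * T (j + j) ∎
      where open ≤-Reasoning

    private
      b : ℕ → ℕ
      b i = T (i + i)

    b-log-convex : ∀ i → b (suc i) * b (suc i) ≤ b i * b (2 + i)
    b-log-convex i = subst (λ z → z * z ≤ b i * b (2 + i)) (cong T (eq i)) (T-cauchy-schwarz i (2 + i))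
      where
      eq : ∀ i → i + (2 + i) ≡ suc i + suc i
      eq = solve-∀

    -- By log-convexity the quotients `b (suc i)` / `b i` do not decrease, so each is at least the
    -- first one.
    b-ratio : ∀ i → b i * b 1 ≤ b (suc i) * b 0
    b-ratio zero    = ≤-reflexive (*-comm (b 0) (b 1))
    b-ratio (suc i) with b i in eq | b-log-convex i | b-ratio i
    -- A vanishing `b i` cannot be cancelled, but log-convexity then makes `b (suc i)` vanish as
    -- well.
    ... | zero  | conv | _  =
      ≤-trans (≤-reflexive (cong (_* b 1) b₁₊ᵢ≡0)) z≤n
      where
      b₁₊ᵢ≡0 : b (suc i) ≡ 0
      b₁₊ᵢ≡0 = n≤0⇒n≡0 (m²≤n²⇒m≤n conv)
    ... | suc p | conv | ih = *-cancelˡ-≤ (suc p) (begin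
      suc p * (b (suc i) * b 1)        ≡⟨ e₁ (suc p) (b (suc i)) (b 1) ⟩
      b (suc i) * (suc p * b 1)        ≤⟨ *-monoʳ-≤ (b (suc i)) ih ⟩
      b (suc i) * (b (suc i) * b 0)    ≡⟨ *-assoc (b (suc i)) _ _ ⟨
      b (suc i) * b (suc i) * b 0      ≤⟨ *-monoˡ-≤ (b 0) conv ⟩
      suc p * b (2 + i) * b 0          ≡⟨ *-assoc (suc p) (b (2 + i)) (b 0) ⟩
      suc p * (b (2 + i) * b 0)        ∎)
      where
      open ≤-Reasoning
      e₁ : ∀ a b c → a * (b * c) ≡ b * (a * c)
      e₁ = solve-∀

    b-power : ∀ i → b 0 * b 1 ^ i ≤ b i * b 0 ^ i
    b-power zero    = ≤-refl
    b-power (suc i) = begin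
      b 0 * (b 1 * b 1 ^ i)      ≡⟨ e₁ (b 0) (b 1) _ ⟩
      (b 0 * b 1 ^ i) * b 1      ≤⟨ *-monoˡ-≤ (b 1) (b-power i) ⟩
      (b i * b 0 ^ i) * b 1      ≡⟨ e₂ (b i) _ (b 1) ⟩
      (b i * b 1) * b 0 ^ i      ≤⟨ *-monoˡ-≤ (b 0 ^ i) (b-ratio i) ⟩
      (b (suc i) * b 0) * b 0 ^ i ≡⟨ *-assoc (b (suc i)) _ _ ⟩
      b (suc i) * b 0 ^ suc i    ∎
      where
      open ≤-Reasoning
      e₁ : ∀ x y z → x * (y * z) ≡ (x * z) * y
      e₁ = solve-∀
      e₂ : ∀ x y z → (x * y) * z ≡ (x * z) * y
      e₂ = solve-∀

    -- Divided out, T(2i)/T(0) ≥ (T(1)/T(0))^(2i). Quotients of even terms are at least T(2)/T(0),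
    -- which Cauchy-Schwarz bounds below by (T(1)/T(0))².
    T-even-lower : ∀ i → T 0 * T 1 ^ (i + i) ≤ T (i + i) * T 0 ^ (i + i)
    T-even-lower i = begin
      T 0 * T 1 ^ (i + i)          ≡⟨ cong (T 0 *_) (trans (^-distribˡ-+-* (T 1) i i) (≡.sym (^-distribʳ-* (T 1) (T 1) i))) ⟩
      T 0 * (T 1 * T 1) ^ i        ≤⟨ *-monoʳ-≤ (T 0) (^-monoˡ-≤ i (T-cauchy-schwarz 0 1)) ⟩
      T 0 * (T 0 * b 1) ^ i        ≡⟨ cong (T 0 *_) (trans (^-distribʳ-* (T 0) (b 1) i) (*-comm _ (b 1 ^ i))) ⟩
      T 0 * (b 1 ^ i * T 0 ^ i)    ≡⟨ *-assoc (T 0) _ _ ⟨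
      T 0 * b 1 ^ i * T 0 ^ i      ≤⟨ *-monoˡ-≤ (T 0 ^ i) (b-power i) ⟩
      b i * T 0 ^ i * T 0 ^ i      ≡⟨ trans (*-assoc (b i) _ _) (cong (b i *_) (≡.sym (^-distribˡ-+-* (T 0) i i))) ⟩
      T (i + i) * T 0 ^ (i + i)    ∎
      where open ≤-Reasoning

    sq-sym : ∀ R → Symmetric R → Symmetric (sq R)
    sq-sym R R-sym f g = ∑-cong xs (λ h → cong (μ h *_)
      (trans (*-comm (R f h) (R h g)) (cong₂ _*_ (R-sym h g) (R-sym f h))))

    double-sym : ∀ R → Symmetric R → ∀ l → Symmetric (double R l)
    double-sym R R-sym zero    = R-sym
    double-sym R R-sym (suc l) = sq-sym _ (double-sym R R-sym l)

    path-sym : ∀ n → Symmetric (path n)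
    path-sym zero    f g = K-sym f g
    path-sym (suc n) f g = begin
      ∑ xs (λ h → μ h * (K f h * path n h g))
        ≡⟨ ∑-cong xs (λ h → cong (μ h *_)
             (trans (*-comm (K f h) _) (cong₂ _*_ (path-sym n h g) (K-sym f h)))) ⟩
      ∑ xs (λ h → μ h * (path n g h * K h f))
        ≡⟨ path-compose n 0 g f ⟨
      path (suc (n + 0)) g f
        ≡⟨ cong (λ z → path (suc z) g f) (+-identityʳ n) ⟩
      path (suc n) g f ∎
      where open ≡-Reasoning

    -- The square of a symmetric kernel is a Gram kernel, and Cauchy-Schwarz bounds its entries by
    -- its diagonal.
    sq-entry : ∀ R → Symmetric R → ∀ f g → sq R f g * sq R g f ≤ sq R f f * sq R g g
    sq-entry R R-sym f g = begin
      sq R f g * sq R g f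
        ≡⟨ cong₂ _*_ (gram f g) (trans (sq-sym R R-sym g f) (gram f g)) ⟩
      _ ≤⟨ cauchy-schwarz xs μ (R f) (R g) ⟩
      _ ≡⟨ cong₂ _*_ (gram f f) (gram g g) ⟨
      sq R f f * sq R g g ∎
      where
      open ≤-Reasoning
      gram : ∀ f g → sq R f g ≡ ∑ xs (λ h → μ h * (R f h * R g h))
      gram f g = ∑-cong xs (λ h → cong (λ z → μ h * (R f h * z)) (R-sym h g))

    tr-sq : ∀ R → tr (sq R) ≡ ∑ xs (λ f → ∑ xs (λ g → (μ f * μ g) * (R f g * R g f)))
    tr-sq R = ∑-cong xs (λ f → trans (≡.sym (∑-*ˡ xs (μ f)))
      (∑-cong xs (λ g → ≡.sym (*-assoc (μ f) (μ g) _))))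

    -- The left side is the sum of the squared entries of `sq R`; bounded through the diagonal, the
    -- double sum factors.
    tr-sq-sq : ∀ R → Symmetric R → tr (sq (sq R)) ≤ tr (sq R) * tr (sq R)
    tr-sq-sq R R-sym = begin
      tr (sq (sq R))
        ≡⟨ tr-sq (sq R) ⟩
      ∑ xs (λ f → ∑ xs (λ g → (μ f * μ g) * (sq R f g * sq R g f)))
        ≤⟨ ∑-mono xs (λ f → ∑-mono xs (λ g → *-monoʳ-≤ (μ f * μ g) (sq-entry R R-sym f g))) ⟩
      ∑ xs (λ f → ∑ xs (λ g → (μ f * μ g) * (sq R f f * sq R g g)))
        ≡⟨ ∑-cong xs (λ f → ∑-cong xs (λ g → *-interchange (μ f) (μ g) (sq R f f) (sq R g g))) ⟩
      ∑ xs (λ f → ∑ xs (λ g → (μ f * sq R f f) * (μ g * sq R g g)))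
        ≡⟨ ∑-* xs xs ⟩
      tr (sq R) * tr (sq R) ∎
      where open ≤-Reasoning

    tr-double : ∀ R → Symmetric R → ∀ l → tr (double R (suc l)) ≤ tr (sq R) ^ 2 ^ l
    tr-double R R-sym zero    = ≤-reflexive (≡.sym (*-identityʳ _))
    tr-double R R-sym (suc l) = begin
      tr (sq (sq (double R l)))                   ≤⟨ tr-sq-sq (double R l) (double-sym R R-sym l) ⟩
      tr (double R (suc l)) * tr (double R (suc l)) ≤⟨ *-mono-≤ (tr-double R R-sym l) (tr-double R R-sym l) ⟩
      tr (sq R) ^ 2 ^ l * tr (sq R) ^ 2 ^ l       ≡⟨ ^-distribˡ-+-* (tr (sq R)) (2 ^ l) (2 ^ l) ⟨
      tr (sq R) ^ (2 ^ l + 2 ^ l)                 ≡⟨ cong (λ z → tr (sq R) ^ (2 ^ l + z)) (+-identityʳ (2 ^ l)) ⟨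
      tr (sq R) ^ 2 ^ suc l                       ∎
      where open ≤-Reasoning

    total : (X → X → ℕ) → ℕ
    total R = ∑ xs (λ f → μ f * Op R (λ _ → 1) f)

    -- Cauchy-Schwarz on pairs, against the constant function: the sum of all entries is compared
    -- with the sum of their squares.
    total² : ∀ R → Symmetric R → total R * total R ≤ (T 0 * T 0) * tr (sq R)
    total² R R-sym = begin
      total R * total R
        ≡⟨ cong₂ _*_ total≡ total≡ ⟩
      _ ≤⟨ cauchy-schwarz ps (λ (f , g) → μ f * μ g) (λ _ → 1) (λ (f , g) → R f g) ⟩
      _ ≡⟨ cong₂ _*_ mass energy ⟩
      (T 0 * T 0) * tr (sq R) ∎
      where
      open ≤-Reasoning
      ps = cartesianProduct xs xs
      e₁ : ∀ a b c → a * (b * (c * 1)) ≡ (a * b) * (1 * c)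
      e₁ = solve-∀
      e₂ : ∀ a b → (a * b) * (1 * 1) ≡ (a * 1) * (b * 1)
      e₂ = solve-∀
      total≡ : total R ≡ ∑ ps (λ (f , g) → (μ f * μ g) * (1 * R f g))
      total≡ = trans (∑-cong xs (λ f → trans (≡.sym (∑-*ˡ xs (μ f)))
          (∑-cong xs (λ g → e₁ (μ f) (μ g) (R f g)))))
        (≡.sym (∑-cartesianProduct xs xs))
      mass : ∑ ps (λ (f , g) → (μ f * μ g) * (1 * 1)) ≡ T 0 * T 0
      mass = trans (∑-cartesianProduct xs xs)
        (trans (∑-cong xs (λ f → ∑-cong xs (λ g → e₂ (μ f) (μ g)))) (∑-* xs xs))
      energy : ∑ ps (λ (f , g) → (μ f * μ g) * (R f g * R f g)) ≡ tr (sq R)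
      energy = trans (∑-cartesianProduct xs xs)
        (trans (∑-cong xs (λ f → ∑-cong xs (λ g → cong (λ z → (μ f * μ g) * (R f g * z)) (R-sym f g))))
               (≡.sym (tr-sq R)))

    -- The left side is the total sum of the entries of `sq D`, with `D` the 2^l-th power of
    -- `path n`. This is at most `T 0` times the root of the sum of squared entries, hence at most
    -- `T 0 * tr (sq D)`, and `tr-double` reduces that trace to the one of `sq (path n)`.
    T≤trace : ∀ n l → T (2 ^ suc l * suc n) ≤ T 0 * tr (sq (path n)) ^ 2 ^ l
    T≤trace n l = begin
      T (2 ^ suc l * suc n)          ≡⟨ ∑-cong xs (λ f → cong (μ f *_)
                                          (trans (cong (λ z → walksFrom z f) (≡.sym (+-identityʳ (2 ^ suc l * suc n))))
                                                 (≡.sym (Op-double-path n (suc l) 0 f)))) ⟩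
      total (sq D)                   ≤⟨ m²≤n²⇒m≤n (begin
        total (sq D) * total (sq D)                     ≤⟨ total² (sq D) (sq-sym D D-sym) ⟩
        (T 0 * T 0) * tr (sq (sq D))                    ≤⟨ *-monoʳ-≤ (T 0 * T 0) (tr-sq-sq D D-sym) ⟩
        (T 0 * T 0) * (tr (sq D) * tr (sq D))           ≡⟨ *-interchange (T 0) (T 0) _ _ ⟩
        (T 0 * tr (sq D)) * (T 0 * tr (sq D))           ∎) ⟩
      T 0 * tr (sq D)                ≤⟨ *-monoʳ-≤ (T 0) (tr-double (path n) (path-sym n) l) ⟩
      T 0 * tr (sq (path n)) ^ 2 ^ l ∎
      where
      open ≤-Reasoning
      D = double (path n) l
      D-sym = double-sym (path n) (path-sym n) l

-- Graphs on lists and homomorphisms from ladders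

∑-mono-∈ : ∀ (xs : List A) {f g : A → ℕ} → (∀ {x} → x ∈ xs → f x ≤ g x) → ∑ xs f ≤ ∑ xs g
∑-mono-∈ []       le = z≤n
∑-mono-∈ (x ∷ xs) le = +-mono-≤ (le (here refl)) (∑-mono-∈ xs (λ x∈ → le (there x∈)))

∑²≤length*∑² : ∀ (xs : List A) (f : A → ℕ) → ∑ xs f * ∑ xs f ≤ length xs * ∑ xs (λ x → f x * f x)
∑²≤length*∑² xs f = begin
  ∑ xs f * ∑ xs f
    ≡⟨ cong₂ _*_ sum≡ sum≡ ⟩
  _ ≤⟨ cauchy-schwarz xs (λ _ → 1) (λ _ → 1) f ⟩
  _ ≡⟨ cong₂ _*_ (trans (∑-const xs 1) (*-identityʳ (length xs))) (∑-cong xs (λ x → *-identityˡ (f x * f x))) ⟩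
  length xs * ∑ xs (λ x → f x * f x) ∎
  where
  open ≤-Reasoning
  sum≡ : ∑ xs f ≡ ∑ xs (λ x → 1 * (1 * f x))
  sum≡ = ∑-cong xs (λ x → ≡.sym (trans (*-identityˡ _) (*-identityˡ _)))

∑-vecs-1 : ∀ (xs : List A) {φ : Vec A 1 → ℕ} → ∑ (vecs 1 xs) φ ≡ ∑ xs (λ x → φ (x ∷ []))
∑-vecs-1 xs = trans (∑-vecs-suc 0 xs) (∑-cong xs (λ x → +-identityʳ _))

∑-vecs-2 : ∀ (xs : List A) {φ : Vec A 2 → ℕ} → ∑ (vecs 2 xs) φ ≡ ∑ xs (λ x → ∑ xs (λ y → φ (x ∷ y ∷ [])))
∑-vecs-2 xs = trans (∑-vecs-suc 1 xs) (∑-cong xs (λ x → ∑-vecs-1 xs))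

Is01 : ℕ → Set
Is01 n = n ≡ 0 ⊎ n ≡ 1

*-01 : ∀ {m n} → Is01 m → Is01 n → Is01 (m * n)
*-01 (inj₁ refl) _           = inj₁ refl
*-01 {m} (inj₂ _) (inj₁ refl) = inj₁ (*-zeroʳ m)
*-01 (inj₂ refl) (inj₂ refl) = inj₂ refl

cross-01 : ∀ {v} (r : A → A → ℕ) → (∀ x y → Is01 (r x y)) → (f g : Vec A v) → Is01 (cross r f g)
cross-01 r r01 []      []      = inj₂ refl
cross-01 r r01 (x ∷ f) (y ∷ g) = *-01 (r01 x y) (cross-01 r r01 f g)

[[≟1]] : ∀ {n} → Is01 n → [[ n ≟ 1 ]] ≡ n
[[≟1]] (inj₁ refl) = refl
[[≟1]] (inj₂ refl) = refl

-- Repeated entries of verts count as distinct vertices.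
record ListGraph : Set₁ where
  field
    Vertex     : Set
    verts      : List Vertex
    rel        : Vertex → Vertex → ℕ
    rel-sym    : ∀ x y → rel x y ≡ rel y x
    rel-01     : ∀ x y → Is01 (rel x y)
    rel-irrefl : ∀ x → rel x x ≡ 0

  order : ℕ
  order = length verts

  deg : Vertex → ℕ
  deg x = ∑ verts (rel x)

  arcs : ℕ
  arcs = ∑ verts deg

open ListGraph

hom : ∀ v → List (Fin v × Fin v) → ListGraph → ℕ
hom v es S = ∑ (vecs v (verts S)) (E es (rel S))

module Ladder (S : ListGraph) (v : ℕ) (es : List (Fin v × Fin v)) where
  open Kernel (Vec (Vertex S) v) (vecs v (verts S)) (E es (rel S)) (cross (rel S)) public
  open Undirected (cross-sym (rel S) (rel-sym S)) public

-- The number of homomorphisms from H □ P into S, where H has edge list es and P is the path with m edges.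
ladder : ∀ v → List (Fin v × Fin v) → ℕ → ListGraph → ℕ
ladder v es m S = Ladder.T S v es m

K₂ : List (Fin 2 × Fin 2)
K₂ = (zero , suc zero) ∷ []

infixr 7 _⊠_
_⊠_ : ListGraph → ListGraph → ListGraph
S ⊠ S′ = record
  { Vertex     = Vertex S × Vertex S′
  ; verts      = cartesianProduct (verts S) (verts S′)
  ; rel        = λ (x , x′) (y , y′) → rel S x y * rel S′ x′ y′
  ; rel-sym    = λ (x , x′) (y , y′) → cong₂ _*_ (rel-sym S x y) (rel-sym S′ x′ y′)
  ; rel-01     = λ (x , x′) (y , y′) → *-01 (rel-01 S x y) (rel-01 S′ x′ y′)
  ; rel-irrefl = λ (x , x′) → cong (_* rel S′ x′ x′) (rel-irrefl S x)
  }

deg-⊠ : ∀ S S′ x x′ → deg (S ⊠ S′) (x , x′) ≡ deg S x * deg S′ x′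
deg-⊠ S S′ x x′ = trans (∑-cartesianProduct (verts S) (verts S′)) (∑-* (verts S) (verts S′))

arcs-⊠ : ∀ S S′ → arcs (S ⊠ S′) ≡ arcs S * arcs S′
arcs-⊠ S S′ = trans (∑-cartesianProduct (verts S) (verts S′))
  (trans (∑-cong (verts S) (λ x → ∑-cong (verts S′) (λ x′ → deg-⊠ S S′ x x′)))
         (∑-* (verts S) (verts S′)))

order-⊠ : ∀ S S′ → order (S ⊠ S′) ≡ order S * order S′
order-⊠ S S′ = length-cartesianProduct (verts S) (verts S′)

module _ (S S′ : ListGraph) (v : ℕ) (es : List (Fin v × Fin v)) where
  private
    module L  = Ladder S v es
    module L′ = Ladder S′ v es
    module P  = Ladder (S ⊠ S′) v es
    V  = vecs v (verts S)
    V′ = vecs v (verts S′)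

    split : ∀ {φ : Vec (Vertex S × Vertex S′) v → ℕ} → ∑ (vecs v (verts (S ⊠ S′))) φ ≡ ∑ V (λ f → ∑ V′ (λ f′ → φ (zipWith _,_ f f′)))
    split = ∑-vecs-zipWith v _,_ (verts S) (verts S′) _ (λ φ → ∑-cartesianProduct (verts S) (verts S′))

    E-split : ∀ f f′ → E es (rel (S ⊠ S′)) (zipWith _,_ f f′) ≡ E es (rel S) f * E es (rel S′) f′
    E-split = E-zipWith _,_ (rel S) (rel S′) (rel (S ⊠ S′)) (λ _ _ _ _ → refl) es

    cross-split : ∀ (f g : Vec (Vertex S) v) (f′ g′ : Vec (Vertex S′) v) → cross (rel (S ⊠ S′)) (zipWith _,_ f f′) (zipWith _,_ g g′)
      ≡ cross (rel S) f g * cross (rel S′) f′ g′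
    cross-split f g f′ g′ = cross-zipWith _,_ (rel S) (rel S′) (rel (S ⊠ S′)) (λ _ _ _ _ → refl) f g f′ g′

  walksFrom-⊠ : ∀ m f f′ → P.walksFrom m (zipWith _,_ f f′) ≡ L.walksFrom m f * L′.walksFrom m f′
  walksFrom-⊠ zero    f f′ = refl
  walksFrom-⊠ (suc m) f f′ = begin
    P.walksFrom (suc m) (zipWith _,_ f f′)
      ≡⟨ split ⟩
    ∑ V (λ g → ∑ V′ (λ g′ → E es (rel (S ⊠ S′)) (zipWith _,_ g g′) *
      (cross (rel (S ⊠ S′)) (zipWith _,_ f f′) (zipWith _,_ g g′) * P.walksFrom m (zipWith _,_ g g′))))
      ≡⟨ ∑-cong V (λ g → ∑-cong V′ (λ g′ → trans
           (cong₂ _*_ (E-split g g′) (cong₂ _*_ (cross-split f g f′ g′) (walksFrom-⊠ m g g′)))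
           (regroup (E es (rel S) g) (E es (rel S′) g′) (cross (rel S) f g) (cross (rel S′) f′ g′) (L.walksFrom m g) (L′.walksFrom m g′)))) ⟩
    ∑ V (λ g → ∑ V′ (λ g′ → (E es (rel S) g * (cross (rel S) f g * L.walksFrom m g)) *
                             (E es (rel S′) g′ * (cross (rel S′) f′ g′ * L′.walksFrom m g′))))
      ≡⟨ ∑-* V V′ ⟩
    L.walksFrom (suc m) f * L′.walksFrom (suc m) f′ ∎
    where
    open ≡-Reasoning
    regroup : ∀ a a′ b b′ c c′ → (a * a′) * ((b * b′) * (c * c′)) ≡ (a * (b * c)) * (a′ * (b′ * c′))
    regroup = solve-∀

  ladder-⊠ : ∀ m → ladder v es m (S ⊠ S′) ≡ ladder v es m S * ladder v es m S′
  ladder-⊠ m = trans split (trans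
    (∑-cong V (λ f → ∑-cong V′ (λ f′ → trans (cong₂ _*_ (E-split f f′) (walksFrom-⊠ m f f′))
      (*-interchange (E es (rel S) f) _ _ _))))
    (∑-* V V′))

induced : (S : ListGraph) {P : Vertex S → Set} → (∀ x → Dec (P x)) → ListGraph
induced S P? = record
  { Vertex = Vertex S ; verts = filter P? (verts S) ; rel = rel S
  ; rel-sym = rel-sym S ; rel-01 = rel-01 S ; rel-irrefl = rel-irrefl S }

module _ (S : ListGraph) {P : Vertex S → Set} (P? : ∀ x → Dec (P x)) (v : ℕ) (es : List (Fin v × Fin v)) where
  private
    module L = Ladder S v es
    module I = Ladder (induced S P?) v es
    sub : vecs v (filter P? (verts S)) ≼ vecs v (verts S)
    sub = vecs-≼ v {filter P? (verts S)} {verts S} (filter-≼ P? (verts S))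

  walksFrom-induced : ∀ m f → I.walksFrom m f ≤ L.walksFrom m f
  walksFrom-induced zero    f = ≤-refl
  walksFrom-induced (suc m) f = ≤-trans (sub _) (∑-mono (vecs v (verts S))
    (λ g → *-monoʳ-≤ (E es (rel S) g) (*-monoʳ-≤ (cross (rel S) f g) (walksFrom-induced m g))))

  ladder-induced : ∀ m → ladder v es m (induced S P?) ≤ ladder v es m S
  ladder-induced m = ≤-trans (sub _) (∑-mono (vecs v (verts S))
    (λ f → *-monoʳ-≤ (E es (rel S) f) (walksFrom-induced m f)))

-- Walk graphs, and bounds for walks and for ladders over an edge

module _ (S : ListGraph) where
  private
    r = rel S

  isWalk : ∀ {m} → Vec (Vertex S) (suc m) → ℕ
  isWalk (x ∷ [])     = 1
  isWalk (x ∷ y ∷ ws) = r x y * isWalk (y ∷ ws)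

  isWalk-01 : ∀ {m} (w : Vec (Vertex S) (suc m)) → Is01 (isWalk w)
  isWalk-01 (x ∷ [])     = inj₂ refl
  isWalk-01 (x ∷ y ∷ ws) = *-01 (rel-01 S x y) (isWalk-01 (y ∷ ws))

  -- Two walks are adjacent when they are adjacent at every time. A homomorphism from H into this
  -- graph thus chooses a walk for each vertex of H, with the time-t positions forming a
  -- homomorphism for each t; this is a homomorphism from H □ P_m.
  walkGraph : ℕ → ListGraph
  walkGraph m = record
    { Vertex     = Vec (Vertex S) (suc m)
    ; verts      = filter (λ w → isWalk w ≟ 1) (vecs (suc m) (verts S))
    ; rel        = cross r
    ; rel-sym    = cross-sym r (rel-sym S)
    ; rel-01     = cross-01 r (rel-01 S)
    ; rel-irrefl = λ { (x ∷ w) → cong (_* cross r w w) (rel-irrefl S x) }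
    }

  ∏-isWalk-step : ∀ {v m} (f : Vec (Vertex S) v) (g : Vec (Vec (Vertex S) (suc m)) v) →
    ∏ isWalk (zipWith _∷_ f g) ≡ cross r f (Vec.map head g) * ∏ isWalk g
  ∏-isWalk-step []      []            = refl
  ∏-isWalk-step (x ∷ f) ((y ∷ w) ∷ g) =
    trans (cong (r x y * isWalk (y ∷ w) *_) (∏-isWalk-step f g)) (*-interchange (r x y) _ _ _)

  heads-step : ∀ {v m} (f : Vec (Vertex S) v) (g : Vec (Vec (Vertex S) (suc m)) v) →
    Vec.map head (zipWith _∷_ f g) ≡ f
  heads-step []      []      = refl
  heads-step (x ∷ f) (w ∷ g) = cong (x ∷_) (heads-step f g)

  module _ (v : ℕ) (es : List (Fin v × Fin v)) where
    open Ladder S v es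

    ∏-isWalk-start : ∀ {v} (f : Vec (Vertex S) v) → ∏ isWalk (Vec.map (_∷ []) f) ≡ 1
    ∏-isWalk-start []      = refl
    ∏-isWalk-start (x ∷ f) = trans (+-identityʳ _) (∏-isWalk-start f)

    E-start : ∀ (es : List (Fin v × Fin v)) f → E es (cross r) (Vec.map (_∷ []) f) ≡ E es r f
    E-start []             f = refl
    E-start ((a , b) ∷ es) f = cong₂ _*_
      (trans (cong₂ (cross r) (lookup-map a (_∷ []) f) (lookup-map b (_∷ []) f)) (*-identityʳ (r (lookup f a) (lookup f b))))
      (E-start es f)

    heads-start : ∀ {v} (f : Vec (Vertex S) v) → Vec.map head (Vec.map (_∷ []) f) ≡ f
    heads-start []      = refl
    heads-start (x ∷ f) = cong (x ∷_) (heads-start f)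

    -- The factor `φ`, evaluated at the initial vertices, makes the induction possible: prepending a
    -- layer `f` to the walks contributes `cross r f` of the old initial layer, and the induction
    -- hypothesis is used with that as its `φ`.
    ∑-walks : ∀ m (φ : Vec (Vertex S) v → ℕ) →
      ∑ (vecs v (vecs (suc m) (verts S))) (λ h → ∏ isWalk h * (E es (cross r) h * φ (Vec.map head h)))
        ≡ ∑ (vecs v (verts S)) (λ f → E es r f * (φ f * walksFrom m f))
    ∑-walks zero φ = trans
      (∑-vecs-map v (_∷ []) (verts S) _ (λ ψ → ∑-vecs-1 (verts S)))
      (∑-cong (vecs v (verts S)) (λ f → trans
        (cong₂ _*_ (∏-isWalk-start f) (cong₂ _*_ (E-start es f) (cong φ (heads-start f))))
        (trans (*-identityˡ _) (cong (E es r f *_) (≡.sym (*-identityʳ (φ f)))))))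
    ∑-walks (suc m) φ = begin
      ∑ (vecs v (vecs (2 + m) (verts S))) (λ h → ∏ isWalk h * (E es (cross r) h * φ (Vec.map head h)))
        ≡⟨ ∑-vecs-zipWith v _∷_ (verts S) (vecs (suc m) (verts S)) _ (λ ψ → ∑-vecs-suc (suc m) (verts S)) ⟩
      ∑ V (λ f → ∑ W (λ g → ∏ isWalk (zipWith _∷_ f g) *
        (E es (cross r) (zipWith _∷_ f g) * φ (Vec.map head (zipWith _∷_ f g)))))
        ≡⟨ ∑-cong V (λ f → ∑-cong W (λ g → trans
             (cong₂ _*_ (∏-isWalk-step f g) (cong₂ _*_
               (E-zipWith _∷_ r (cross r) (cross r) (λ _ _ _ _ → refl) es f g) (cong φ (heads-step f g))))
             (regroup (cross r f (Vec.map head g)) (∏ isWalk g) (E es r f) (E es (cross r) g) (φ f)))) ⟩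
      ∑ V (λ f → ∑ W (λ g → (E es r f * φ f) * (∏ isWalk g * (E es (cross r) g * cross r f (Vec.map head g)))))
        ≡⟨ ∑-cong V (λ f → trans (∑-*ˡ W (E es r f * φ f))
             (trans (cong ((E es r f * φ f) *_) (∑-walks m (cross r f))) (*-assoc (E es r f) (φ f) _))) ⟩
      ∑ V (λ f → E es r f * (φ f * walksFrom (suc m) f)) ∎
      where
      open ≡-Reasoning
      V = vecs v (verts S)
      W = vecs v (vecs (suc m) (verts S))
      regroup : ∀ c w e e′ p → (c * w) * ((e * e′) * p) ≡ (e * p) * (w * (e′ * c))
      regroup = solve-∀

    hom-walkGraph : ∀ m → hom v es (walkGraph m) ≡ ladder v es m S
    hom-walkGraph m = begin
      hom v es (walkGraph m)
        ≡⟨ ∑-vecs-filter v (λ w → isWalk w ≟ 1) (vecs (suc m) (verts S)) ⟩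
      ∑ W (λ h → ∏ (λ w → [[ isWalk w ≟ 1 ]]) h * E es (cross r) h)
        ≡⟨ ∑-cong W (λ h → cong₂ _*_ (∏-cong h) (≡.sym (*-identityʳ _))) ⟩
      ∑ W (λ h → ∏ isWalk h * (E es (cross r) h * 1))
        ≡⟨ ∑-walks m (λ _ → 1) ⟩
      ∑ V (λ f → E es r f * (1 * walksFrom m f))
        ≡⟨ ∑-cong V (λ f → cong (E es r f *_) (*-identityˡ _)) ⟩
      ladder v es m S ∎
      where
      open ≡-Reasoning
      V = vecs v (verts S)
      W = vecs v (vecs (suc m) (verts S))
      ∏-cong : ∀ {v} (h : Vec (Vec (Vertex S) (suc m)) v) → ∏ (λ w → [[ isWalk w ≟ 1 ]]) h ≡ ∏ isWalk h
      ∏-cong []      = refl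
      ∏-cong (w ∷ h) = cong₂ _*_ ([[≟1]] (isWalk-01 w)) (∏-cong h)

  -- Together with `hom-K₂` this lets the one identity `hom-walkGraph` also compute the order and
  -- the arcs of a walk graph, as ladders over K₁ and K₂.
  hom-K₁ : hom 1 [] S ≡ order S
  hom-K₁ = trans (∑-vecs-1 (verts S)) (trans (∑-const (verts S) 1) (*-identityʳ _))

  hom-K₂ : hom 2 K₂ S ≡ arcs S
  hom-K₂ = trans (∑-vecs-2 (verts S)) (∑-cong (verts S) (λ x → ∑-cong (verts S) (λ y → *-identityʳ _)))

  ladder-0 : ∀ v es → ladder v es 0 S ≡ hom v es S
  ladder-0 v es = ∑-cong (vecs v (verts S)) (λ f → *-identityʳ _)

  ladder-K₁-1 : ladder 1 [] 1 S ≡ arcs S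
  ladder-K₁-1 = trans (∑-vecs-1 (verts S)) (∑-cong (verts S) (λ x → trans (*-identityˡ _)
    (trans (∑-vecs-1 (verts S)) (∑-cong (verts S) (λ y → simp (r x y))))))
    where
    simp : ∀ a → 1 * ((a * 1) * 1) ≡ a
    simp = solve-∀

  -- The Blakley-Roy inequality for walks of even length, as the case H = K₁ of the kernel
  -- inequality.
  ladder-K₁-lower : ∀ i → order S * arcs S ^ (i + i) ≤ ladder 1 [] (i + i) S * order S ^ (i + i)
  ladder-K₁-lower i = ≡.subst₂ (λ n M → n * M ^ (i + i) ≤ ladder 1 [] (i + i) S * n ^ (i + i))
    (trans (ladder-0 1 []) hom-K₁) ladder-K₁-1 (Ladder.T-even-lower S 1 [] i)

  walksFrom-K₁-upper : ∀ {Δ} → (∀ {x} → x ∈ verts S → deg S x ≤ Δ) →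
    ∀ m {x} → x ∈ verts S → Ladder.walksFrom S 1 [] m (x ∷ []) ≤ Δ ^ m
  walksFrom-K₁-upper deg≤Δ zero    x∈ = ≤-refl
  walksFrom-K₁-upper {Δ} deg≤Δ (suc m) {x} x∈ = begin
    Ladder.walksFrom S 1 [] (suc m) (x ∷ [])
      ≡⟨ ∑-vecs-1 (verts S) ⟩
    ∑ (verts S) (λ y → 1 * ((r x y * 1) * Ladder.walksFrom S 1 [] m (y ∷ [])))
      ≤⟨ ∑-mono-∈ (verts S) (λ {y} y∈ → ≤-trans (≤-reflexive (simp (r x y) _))
           (*-monoʳ-≤ (r x y) (walksFrom-K₁-upper deg≤Δ m y∈))) ⟩
    ∑ (verts S) (λ y → r x y * Δ ^ m)
      ≡⟨ ∑-*ʳ (verts S) (Δ ^ m) ⟩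
    deg S x * Δ ^ m
      ≤⟨ *-monoˡ-≤ (Δ ^ m) (deg≤Δ x∈) ⟩
    Δ * Δ ^ m ∎
    where
    open ≤-Reasoning
    simp : ∀ a b → 1 * ((a * 1) * b) ≡ a * b
    simp = solve-∀

  -- Walk counts also occur on the larger side of Sidorenko's inequality for the walk graph; this
  -- bounds them there, and it is the place where the maximal degree enters.
  ladder-K₁-upper : ∀ {Δ} → (∀ {x} → x ∈ verts S → deg S x ≤ Δ) →
    ∀ m → ladder 1 [] m S ≤ order S * Δ ^ m
  ladder-K₁-upper {Δ} deg≤Δ m = begin
    ladder 1 [] m S                                                 ≡⟨ ∑-vecs-1 (verts S) ⟩
    ∑ (verts S) (λ x → 1 * Ladder.walksFrom S 1 [] m (x ∷ []))      ≤⟨ ∑-mono-∈ (verts S) (λ x∈ →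
      ≤-trans (≤-reflexive (*-identityˡ _)) (walksFrom-K₁-upper deg≤Δ m x∈)) ⟩
    ∑ (verts S) (λ _ → Δ ^ m)                                       ≡⟨ ∑-const (verts S) (Δ ^ m) ⟩
    order S * Δ ^ m                                                 ∎
    where open ≤-Reasoning

  codeg : Vertex S → Vertex S → ℕ
  codeg z w = ∑ (verts S) (λ x → r x z * r x w)

  ladder-K₂-1 : ladder 2 K₂ 1 S ≡ ∑ (verts S) (λ z → ∑ (verts S) (λ w → codeg z w * codeg z w))
  ladder-K₂-1 = begin
    ladder 2 K₂ 1 S
      ≡⟨ ∑-vecs-2 V ⟩
    ∑ V (λ x → ∑ V (λ z → (r x z * 1) * Ladder.walksFrom S 2 K₂ 1 (x ∷ z ∷ [])))
      ≡⟨ ∑-cong V (λ x → ∑-cong V (λ z → trans (cong ((r x z * 1) *_) (∑-vecs-2 V))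
           (≡.sym (∑-*ˡ V (r x z * 1))))) ⟩
    ∑ V (λ x → ∑ V (λ z → ∑ V (λ w → (r x z * 1) * ∑ V (λ y → (r w y * 1) * ((r x w * (r z y * 1)) * 1)))))
      ≡⟨ ∑-cong V (λ x → ∑-cong V (λ z → ∑-cong V (λ w → trans (≡.sym (∑-*ˡ V (r x z * 1)))
           (trans (∑-cong V (λ y → trans (shuffle (r x z) (r w y) (r x w) (r z y))
             (cong₂ (λ a b → (r x z * r x w) * (a * b)) (rel-sym S z y) (rel-sym S w y))))
             (∑-*ˡ V (r x z * r x w)))))) ⟩
    ∑ V (λ x → ∑ V (λ z → ∑ V (λ w → (r x z * r x w) * codeg z w)))
      ≡⟨ ∑-swap V V ⟩
    ∑ V (λ z → ∑ V (λ x → ∑ V (λ w → (r x z * r x w) * codeg z w)))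
      ≡⟨ ∑-cong V (λ z → trans (∑-swap V V) (∑-cong V (λ w → ∑-*ʳ V (codeg z w)))) ⟩
    ∑ V (λ z → ∑ V (λ w → codeg z w * codeg z w)) ∎
    where
    open ≡-Reasoning
    V = verts S
    shuffle : ∀ a b c d → (a * 1) * ((b * 1) * ((c * (d * 1)) * 1)) ≡ (a * c) * (d * b)
    shuffle = solve-∀

  -- Walks of length two, counted by their end points and by their middle vertex.
  ∑-codeg : ∑ (verts S) (λ z → ∑ (verts S) (codeg z)) ≡ ∑ (verts S) (λ x → deg S x * deg S x)
  ∑-codeg = begin
    ∑ V (λ z → ∑ V (λ w → ∑ V (λ x → r x z * r x w)))  ≡⟨ ∑-cong V (λ z → ∑-swap V V) ⟩
    ∑ V (λ z → ∑ V (λ x → ∑ V (λ w → r x z * r x w)))  ≡⟨ ∑-swap V V ⟩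
    ∑ V (λ x → ∑ V (λ z → ∑ V (λ w → r x z * r x w)))  ≡⟨ ∑-cong V (λ x → ∑-* V V) ⟩
    ∑ V (λ x → deg S x * deg S x)                      ∎
    where
    open ≡-Reasoning
    V = verts S

  -- The ladder K₂ □ K₂ is C₄, and its homomorphisms are counted by squared codegrees.
  -- Cauchy-Schwarz is used twice: from arcs to squared degrees, which sum to the codegrees, and
  -- from codegrees to their squares.
  C₄-lower : arcs S ^ 4 ≤ ladder 2 K₂ 1 S * order S ^ 4
  C₄-lower = begin
    M ^ 4                                   ≡⟨ fourth M ⟩
    (M * M) * (M * M)                       ≤⟨ *-mono-≤ M²≤ M²≤ ⟩
    (N * D) * (N * D)                       ≡⟨ *-interchange N D N D ⟩
    (N * N) * (D * D)                       ≤⟨ *-monoʳ-≤ (N * N) D²≤ ⟩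
    (N * N) * ((N * N) * ladder 2 K₂ 1 S)   ≡⟨ final N (ladder 2 K₂ 1 S) ⟩
    ladder 2 K₂ 1 S * N ^ 4                 ∎
    where
    open ≤-Reasoning
    V = verts S
    N = order S
    M = arcs S
    D = ∑ V (λ x → deg S x * deg S x)
    fourth : ∀ a → a * (a * (a * (a * 1))) ≡ (a * a) * (a * a)
    fourth = solve-∀
    final : ∀ a b → (a * a) * ((a * a) * b) ≡ b * (a * (a * (a * (a * 1))))
    final = solve-∀
    M²≤ : M * M ≤ N * D
    M²≤ = ∑²≤length*∑² V (deg S)
    ps = cartesianProduct V V
    D²≤ : D * D ≤ (N * N) * ladder 2 K₂ 1 S
    D²≤ = ≤-trans
      (≤-reflexive (cong₂ _*_ D≡ D≡))
      (≤-trans (∑²≤length*∑² ps (λ (z , w) → codeg z w))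
        (≤-reflexive (cong₂ _*_ (order-⊠ S S) (trans (∑-cartesianProduct V V) (≡.sym ladder-K₂-1)))))
      where
      D≡ : D ≡ ∑ ps (λ (z , w) → codeg z w)
      D≡ = trans (≡.sym ∑-codeg) (≡.sym (∑-cartesianProduct V V))

  -- For the kernel over K₂, `T 0` counts arcs and `T 1` counts homomorphisms from C₄, so `C₄-lower`
  -- turns this into a bound by arcs and order.
  ladder-K₂-lower : ∀ i → arcs S * ladder 2 K₂ 1 S ^ (i + i) ≤ ladder 2 K₂ (i + i) S * arcs S ^ (i + i)
  ladder-K₂-lower i = subst (λ M → M * ladder 2 K₂ 1 S ^ (i + i) ≤ ladder 2 K₂ (i + i) S * M ^ (i + i))
    (trans (ladder-0 2 K₂) hom-K₂) (Ladder.T-even-lower S 2 K₂ i)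

-- Dyadic degree classes

∑-∈-≤ : ∀ {xs : List A} {f : A → ℕ} {x} → x ∈ xs → f x ≤ ∑ xs f
∑-∈-≤ (here refl)         = m≤m+n _ _
∑-∈-≤ {f = f} (there {x} x∈) = ≤-trans (∑-∈-≤ x∈) (m≤n+m _ (f x))

dyadic-class : ∀ q {d} → 1 ≤ d → d < 2 ^ q → ∃ λ i → i < q × (2 ^ i ≤ d × d < 2 ^ suc i)
dyadic-class zero    1≤d d<1 = ⊥-elim (<⇒≱ d<1 1≤d)
dyadic-class (suc q) {d} 1≤d d<2^ with 2 ^ q ≤? d
... | yes 2^q≤d = q , ≤-refl , 2^q≤d , d<2^
... | no  2^q≰d with dyadic-class q 1≤d (≰⇒> 2^q≰d)
... | i , i<q , bounds = i , m≤n⇒m≤1+n i<q , bounds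

module DegreeClasses (S : ListGraph) (q : ℕ) (1≤arcs : 1 ≤ arcs S) (arcs<2^q : arcs S < 2 ^ q) where
  private
    V = verts S
    r = rel S

  inClass? : ∀ i x → Dec (2 ^ i ≤ deg S x × deg S x < 2 ^ suc i)
  inClass? i x = (2 ^ i ≤? deg S x) ×-dec (deg S x <? 2 ^ suc i)

  -- The window has ratio 4, because degrees multiply in the tensor square and each factor is known
  -- up to 2.
  inPairClass? : ∀ c (z : Vertex (S ⊠ S)) → Dec (2 ^ c ≤ deg (S ⊠ S) z × deg (S ⊠ S) z < 2 ^ (2 + c))
  inPairClass? c z = (2 ^ c ≤? deg (S ⊠ S) z) ×-dec (deg (S ⊠ S) z <? 2 ^ (2 + c))

  pairClass : ℕ → ListGraph
  pairClass c = induced (S ⊠ S) (inPairClass? c)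

  between : ℕ → ℕ → ℕ
  between i j = ∑ V (λ x → ∑ V (λ y → [[ inClass? i x ]] * ([[ inClass? j y ]] * r x y)))

  between-sym : ∀ i j → between i j ≡ between j i
  between-sym i j = trans (∑-swap V V) (∑-cong V (λ y → ∑-cong V (λ x →
    trans (swap-factors [[ inClass? i x ]] [[ inClass? j y ]] (r x y))
          (cong (λ z → [[ inClass? j y ]] * ([[ inClass? i x ]] * z)) (rel-sym S x y)))))
    where
    swap-factors : ∀ a b c → a * (b * c) ≡ b * (a * c)
    swap-factors = solve-∀

  classes-multiply : ∀ i j x y → [[ inClass? i x ]] * [[ inClass? j y ]] ≤ [[ inPairClass? (i + j) (x , y) ]]
  classes-multiply i j x y with inClass? i x | inClass? j y
  ... | no  _             | _      = z≤n
  ... | yes _             | no _   = z≤n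
  ... | yes (lo , hi)     | yes (lo′ , hi′) =
    ≤-reflexive (≡.sym ([[ inPairClass? (i + j) (x , y) ]]-yes (lower , upper)))
    where
    lower : 2 ^ (i + j) ≤ deg (S ⊠ S) (x , y)
    lower = ≤-trans (≤-reflexive (^-distribˡ-+-* 2 i j))
      (≤-trans (*-mono-≤ lo lo′) (≤-reflexive (≡.sym (deg-⊠ S S x y))))
    four : ∀ a b → (2 * a) * (2 * b) ≡ 2 * (2 * (a * b))
    four = solve-∀
    upper : deg (S ⊠ S) (x , y) < 2 ^ (2 + (i + j))
    upper = ≤-trans (s≤s (≤-reflexive (deg-⊠ S S x y)))
      (≤-trans (*-mono-< hi hi′) (≤-reflexive (trans (four (2 ^ i) (2 ^ j))
        (cong (λ z → 2 * (2 * z)) (≡.sym (^-distribˡ-+-* 2 i j))))))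

  -- An edge between classes i and j, paired with one between j and i, joins two pairs of class i + j.
  between²≤arcs : ∀ i j → between i j * between i j ≤ arcs (pairClass (i + j))
  between²≤arcs i j = begin
    between i j * between i j
      ≡⟨ cong (between i j *_) (between-sym i j) ⟩
    between i j * between j i
      ≡⟨ ∑-* V V ⟨
    ∑ V (λ x → ∑ V (λ y → ∑ V (f x) * ∑ V (g y)))
      ≡⟨ ∑-cong V (λ x → ∑-cong V (λ y → ∑-* V V)) ⟨
    ∑ V (λ x → ∑ V (λ y → ∑ V (λ x′ → ∑ V (λ y′ → f x x′ * g y y′))))
      ≤⟨ ∑-mono V (λ x → ∑-mono V (λ y → ∑-mono V (λ x′ → ∑-mono V (λ y′ → termwise x y x′ y′)))) ⟩
    ∑ V (λ x → ∑ V (λ y → ∑ V (λ x′ → ∑ V (λ y′ → p x y * (p x′ y′ * (r x x′ * r y y′))))))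
      ≡⟨ ∑-cong V (λ x → ∑-cong V (λ y → trans
           (∑-cong V (λ x′ → ∑-*ˡ V (p x y))) (∑-*ˡ V (p x y)))) ⟩
    ∑ V (λ x → ∑ V (λ y → p x y * ∑ V (λ x′ → ∑ V (λ y′ → p x′ y′ * (r x x′ * r y y′)))))
      ≡⟨ ∑-cong V (λ x → ∑-cong V (λ y → cong (p x y *_) (trans
           (∑-filter (inPairClass? (i + j)) (verts (S ⊠ S))) (∑-cartesianProduct V V)))) ⟨
    ∑ V (λ x → ∑ V (λ y → p x y * deg (pairClass (i + j)) (x , y)))
      ≡⟨ trans (∑-filter (inPairClass? (i + j)) (verts (S ⊠ S))) (∑-cartesianProduct V V) ⟨
    arcs (pairClass (i + j)) ∎
    where
    open ≤-Reasoning
    f = λ x y → [[ inClass? i x ]] * ([[ inClass? j y ]] * r x y)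
    g = λ x y → [[ inClass? j x ]] * ([[ inClass? i y ]] * r x y)
    p = λ x y → [[ inPairClass? (i + j) (x , y) ]]
    regroup : ∀ a b c d s t → (a * (b * s)) * (c * (d * t)) ≡ (a * c) * ((b * d) * (s * t))
    regroup = solve-∀
    termwise : ∀ x y x′ y′ → f x x′ * g y y′ ≤ p x y * (p x′ y′ * (r x x′ * r y y′))
    termwise x y x′ y′ = ≤-trans
      (≤-reflexive (regroup [[ inClass? i x ]] [[ inClass? j x′ ]] [[ inClass? j y ]] [[ inClass? i y′ ]] (r x x′) (r y y′)))
      (*-mono-≤ (classes-multiply i j x y) (*-monoˡ-≤ (r x x′ * r y y′)
        (subst (λ c → [[ inClass? j x′ ]] * [[ inClass? i y′ ]] ≤ [[ inPairClass? c (x′ , y′) ]])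
          (+-comm j i) (classes-multiply j i x′ y′))))

  private
    Q = upTo q

  classified : ∀ {x} → x ∈ V → 1 ≤ deg S x → 1 ≤ ∑ Q (λ i → [[ inClass? i x ]])
  classified {x} x∈ 1≤deg with dyadic-class q 1≤deg (≤-trans (s≤s (∑-∈-≤ x∈)) arcs<2^q)
  ... | i , i<q , bounds = ≤-trans (≤-reflexive (≡.sym ([[ inClass? i x ]]-yes bounds)))
    (∑-∈-≤ {f = λ i → [[ inClass? i x ]]} (∈-upTo⁺ i<q))

  -- A vertex of degree zero has no class, but the end points of an arc have positive degree, so no
  -- arc escapes the classification.
  rel≤classified : ∀ {x y} → x ∈ V → y ∈ V →
    r x y ≤ ∑ Q (λ i → [[ inClass? i x ]]) * (∑ Q (λ j → [[ inClass? j y ]]) * r x y)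
  rel≤classified {x} {y} x∈ y∈ with rel-01 S x y
  ... | inj₁ r≡0 = ≤-trans (≤-reflexive r≡0) z≤n
  ... | inj₂ r≡1 = begin
    r x y              ≡⟨ trans (*-identityˡ (1 * r x y)) (*-identityˡ (r x y)) ⟨
    1 * (1 * r x y)    ≤⟨ *-mono-≤ (classified x∈ 1≤degx) (*-monoˡ-≤ (r x y) (classified y∈ 1≤degy)) ⟩
    _                  ∎
    where
    open ≤-Reasoning
    1≤degx : 1 ≤ deg S x
    1≤degx = ≤-trans (≤-reflexive (≡.sym r≡1)) (∑-∈-≤ {f = r x} y∈)
    1≤degy : 1 ≤ deg S y
    1≤degy = ≤-trans (≤-reflexive (≡.sym (trans (rel-sym S y x) r≡1))) (∑-∈-≤ {f = r y} x∈)

  arcs≤∑between : arcs S ≤ ∑ Q (λ i → ∑ Q (between i))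
  arcs≤∑between = begin
    arcs S
      ≤⟨ ∑-mono-∈ V (λ x∈ → ∑-mono-∈ V (λ y∈ → rel≤classified x∈ y∈)) ⟩
    ∑ V (λ x → ∑ V (λ y → ∑ Q (cls x) * (∑ Q (cls y) * r x y)))
      ≡⟨ ∑-cong V (λ x → ∑-cong V (λ y → trans (cong (∑ Q (cls x) *_) (≡.sym (∑-*ʳ Q (r x y)))) (≡.sym (∑-* Q Q)))) ⟩
    ∑ V (λ x → ∑ V (λ y → ∑ Q (λ i → ∑ Q (λ j → cls x i * (cls y j * r x y)))))
      ≡⟨ ∑-cong V (λ x → trans (∑-swap V Q) (∑-cong Q (λ i → ∑-swap V Q))) ⟩
    ∑ V (λ x → ∑ Q (λ i → ∑ Q (λ j → ∑ V (λ y → cls x i * (cls y j * r x y)))))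
      ≡⟨ trans (∑-swap V Q) (∑-cong Q (λ i → ∑-swap V Q)) ⟩
    ∑ Q (λ i → ∑ Q (between i)) ∎
    where
    open ≤-Reasoning
    cls = λ x i → [[ inClass? i x ]]

  length-Q² : length (cartesianProduct Q Q) ≡ q * q
  length-Q² = trans (length-cartesianProduct Q Q) (cong₂ _*_ (List.length-upTo q) (List.length-upTo q))

  1≤q : 1 ≤ q
  1≤q = n≢0⇒n>0 (λ q≡0 → <⇒≱ (subst (λ q → arcs S < 2 ^ q) q≡0 arcs<2^q) 1≤arcs)

  popular : ∃ λ i → ∃ λ j → arcs S ≤ (q * q) * between i j
  popular with ∑-pigeonhole (cartesianProduct Q Q) (λ (i , j) → between i j)
                 (≤-trans (*-mono-≤ 1≤q 1≤q) (≤-reflexive (≡.sym length-Q²)))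
  ... | (i , j) , le = i , j , (begin
    arcs S                                               ≤⟨ arcs≤∑between ⟩
    ∑ Q (λ i → ∑ Q (between i))                          ≡⟨ ∑-cartesianProduct Q Q ⟨
    ∑ (cartesianProduct Q Q) (λ (i , j) → between i j)   ≤⟨ le ⟩
    length (cartesianProduct Q Q) * between i j          ≡⟨ cong (_* between i j) length-Q² ⟩
    (q * q) * between i j                                ∎)
    where open ≤-Reasoning

  pairClass-arcs-lower : ∃ λ c → arcs S * arcs S ≤ q ^ 4 * arcs (pairClass c)
  pairClass-arcs-lower with popular
  ... | i , j , le = i + j , (begin
    arcs S * arcs S                                   ≤⟨ *-mono-≤ le le ⟩
    ((q * q) * between i j) * ((q * q) * between i j) ≡⟨ fourth q (between i j) ⟩
    q ^ 4 * (between i j * between i j)               ≤⟨ *-monoʳ-≤ (q ^ 4) (between²≤arcs i j) ⟩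
    q ^ 4 * arcs (pairClass (i + j))                  ∎)
    where
    open ≤-Reasoning
    fourth : ∀ a b → ((a * a) * b) * ((a * a) * b) ≡ (a * (a * (a * (a * 1)))) * (b * b)
    fourth = solve-∀

  module _ (c : ℕ) where
    private
      Z = pairClass c

      Z≼ : verts Z ≼ verts (S ⊠ S)
      Z≼ = filter-≼ (inPairClass? c) (verts (S ⊠ S))

    pairClass-arcs-upper : arcs Z ≤ arcs S * arcs S
    pairClass-arcs-upper = ≤-trans (Z≼ (deg Z))
      (≤-trans (∑-mono (verts (S ⊠ S)) (λ z → Z≼ (rel Z z))) (≤-reflexive (arcs-⊠ S S)))

    pairClass-order-upper : order Z ≤ order S * order S
    pairClass-order-upper = begin
      order Z                             ≡⟨ trans (∑-const (verts Z) 1) (*-identityʳ _) ⟨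
      ∑ (verts Z) (λ _ → 1)               ≤⟨ Z≼ (λ _ → 1) ⟩
      ∑ (verts (S ⊠ S)) (λ _ → 1)         ≡⟨ trans (∑-const (verts (S ⊠ S)) 1) (*-identityʳ _) ⟩
      order (S ⊠ S)                       ≡⟨ order-⊠ S S ⟩
      order S * order S                   ∎
      where open ≤-Reasoning

    pairClass-deg-upper : ∀ {z} → z ∈ verts Z → deg Z z ≤ 2 ^ (2 + c)
    pairClass-deg-upper {z} z∈ = ≤-trans (Z≼ (rel Z z))
      (<⇒≤ (proj₂ (proj₂ (∈-filter⁻ (inPairClass? c) {xs = verts (S ⊠ S)} z∈))))

    -- Near-regularity in the form used later: every vertex of the class has degree at least 2^c in
    -- `S ⊠ S`, so the order times 2^c is at most the arcs there. The maximal degree is at most four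
    -- times this 2^c.
    pairClass-order*deg : order Z * 2 ^ (2 + c) ≤ 4 * (arcs S * arcs S)
    pairClass-order*deg = begin
      order Z * 2 ^ (2 + c)               ≡⟨ four (order Z) (2 ^ c) ⟩
      4 * (order Z * 2 ^ c)               ≡⟨ cong (4 *_) (∑-const (verts Z) (2 ^ c)) ⟨
      4 * ∑ (verts Z) (λ _ → 2 ^ c)       ≤⟨ *-monoʳ-≤ 4 (∑-mono-∈ (verts Z) (λ z∈ →
                                               proj₁ (proj₂ (∈-filter⁻ (inPairClass? c) {xs = verts (S ⊠ S)} z∈)))) ⟩
      4 * ∑ (verts Z) (deg (S ⊠ S))       ≤⟨ *-monoʳ-≤ 4 (Z≼ (deg (S ⊠ S))) ⟩
      4 * arcs (S ⊠ S)                    ≡⟨ cong (4 *_) (arcs-⊠ S S) ⟩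
      4 * (arcs S * arcs S)               ∎
      where
      open ≤-Reasoning
      four : ∀ a b → a * (2 * (2 * b)) ≡ 4 * (a * b)
      four = solve-∀

-- Exponential growth and limits of roots

n<2^n : ∀ n → n < 2 ^ n
n<2^n zero    = ≤-refl
n<2^n (suc n) = begin
  suc (suc n)       ≤⟨ s≤s (n<2^n n) ⟩
  suc (2 ^ n)       ≤⟨ +-monoˡ-≤ (2 ^ n) (m^n>0 2 n) ⟩
  2 ^ n + 2 ^ n     ≡⟨ cong (2 ^ n +_) (+-identityʳ (2 ^ n)) ⟨
  2 ^ suc n         ∎
  where open ≤-Reasoning

-- Bernoulli's inequality (1 + 1/b)^R ≥ 1 + R/b with denominators cleared.
bernoulli : ∀ b R → (b + R) * b ^ R ≤ b * suc b ^ R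
bernoulli b zero    = ≤-reflexive (cong (_* 1) (+-identityʳ b))
bernoulli b (suc R) = begin
  (b + suc R) * (b * b ^ R)              ≤⟨ m≤m+n _ (R * b ^ R) ⟩
  (b + suc R) * (b * b ^ R) + R * b ^ R  ≡⟨ expand b R (b ^ R) ⟩
  suc b * ((b + R) * b ^ R)              ≤⟨ *-monoʳ-≤ (suc b) (bernoulli b R) ⟩
  suc b * (b * suc b ^ R)                ≡⟨ swap-factors (suc b) b (suc b ^ R) ⟩
  b * suc b ^ suc R                      ∎
  where
  open ≤-Reasoning
  expand : ∀ b R p → (b + suc R) * (b * p) + R * p ≡ suc b * ((b + R) * p)
  expand = solve-∀
  swap-factors : ∀ a b c → a * (b * c) ≡ b * (a * c)
  swap-factors = solve-∀

^-doubles : ∀ b R → 1 ≤ b → b ≤ R → 2 * b ^ R ≤ suc b ^ R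
^-doubles b R 1≤b b≤R = *-cancelˡ-≤ b {{>-nonZero 1≤b}} (begin
  b * (2 * b ^ R)    ≡⟨ eq b (b ^ R) ⟩
  (b + b) * b ^ R    ≤⟨ *-monoˡ-≤ (b ^ R) (+-monoʳ-≤ b b≤R) ⟩
  (b + R) * b ^ R    ≤⟨ bernoulli b R ⟩
  b * suc b ^ R      ∎)
  where
  open ≤-Reasoning
  eq : ∀ b p → b * (2 * p) ≡ (b + b) * p
  eq = solve-∀

2^-beats-linear : ∀ c p → ∃ λ i → c + i * p ≤ 2 ^ i
-- With the exponent 2t the right side is at least t², while the left side is at most t (c + 2p); so
-- t only has to exceed c + 2p.
2^-beats-linear c p = t + t , (begin
  c + (t + t) * p           ≤⟨ +-monoˡ-≤ _ (m≤m*n c t) ⟩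
  c * t + (t + t) * p       ≡⟨ eq c t p ⟩
  t * (c + 2 * p)           ≤⟨ *-monoʳ-≤ t (n≤1+n (c + 2 * p)) ⟩
  t * t                     ≤⟨ *-mono-≤ (<⇒≤ (n<2^n t)) (<⇒≤ (n<2^n t)) ⟩
  2 ^ t * 2 ^ t             ≡⟨ ^-distribˡ-+-* 2 t t ⟨
  2 ^ (t + t)               ∎)
  where
  open ≤-Reasoning
  t = suc (c + 2 * p)
  eq : ∀ c t p → c * t + (t + t) * p ≡ t * (c + 2 * p)
  eq = solve-∀

-- Polynomial factors disappear in the limit of 2^j-th roots.
root-limit : ∀ s b C p → (∀ j → s ^ 2 ^ j ≤ C * (2 ^ j) ^ p * b ^ 2 ^ j) → s ≤ b
root-limit s b C p bound with s ≤? b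
... | yes s≤b = s≤b
... | no  s≰b = ⊥-elim (contradict b (≰⇒> s≰b) bound)
  where
  contradict : ∀ b → b < s → (∀ j → s ^ 2 ^ j ≤ C * (2 ^ j) ^ p * b ^ 2 ^ j) → ⊥
  -- For b = 0 the bound at j = 0 already says s ≤ 0.
  contradict zero    0<s bound = <⇒≱ (≤-trans 0<s (≤-reflexive (≡.sym (*-identityʳ s))))
    (≤-trans (bound 0) (≤-reflexive (*-zeroʳ (C * (2 ^ 0) ^ p))))
  -- The exponent is split as 2^b times 2^i: passing from b to b + 1 gains a factor 2 over 2^b
  -- factors, hence 2^(2^i) in all, and `i` is chosen so that this exceeds the polynomial factor.
  contradict b@(suc b-1) b<s bound = <⇒≱ too-small (begin
    2 ^ 2 ^ i * b ^ 2 ^ (b + i)        ≡⟨ cong (λ z → 2 ^ 2 ^ i * z) b^-split ⟩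
    2 ^ 2 ^ i * (b ^ 2 ^ b) ^ 2 ^ i    ≡⟨ ^-distribʳ-* 2 (b ^ 2 ^ b) (2 ^ i) ⟨
    (2 * b ^ 2 ^ b) ^ 2 ^ i            ≤⟨ ^-monoˡ-≤ (2 ^ i) (^-doubles b (2 ^ b) (s≤s z≤n) (<⇒≤ (n<2^n b))) ⟩
    (suc b ^ 2 ^ b) ^ 2 ^ i            ≤⟨ ^-monoˡ-≤ (2 ^ i) (^-monoˡ-≤ (2 ^ b) b<s) ⟩
    (s ^ 2 ^ b) ^ 2 ^ i                ≡⟨ trans (^-*-assoc s (2 ^ b) (2 ^ i)) (cong (s ^_) (≡.sym (^-distribˡ-+-* 2 b i))) ⟩
    s ^ 2 ^ (b + i)                    ≤⟨ bound (b + i) ⟩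
    C * (2 ^ (b + i)) ^ p * b ^ 2 ^ (b + i) ∎)
    where
    open ≤-Reasoning
    C′ = C * (2 ^ b) ^ p
    i = proj₁ (2^-beats-linear C′ p)
    b^-split : b ^ 2 ^ (b + i) ≡ (b ^ 2 ^ b) ^ 2 ^ i
    b^-split = trans (cong (b ^_) (^-distribˡ-+-* 2 b i)) (≡.sym (^-*-assoc b (2 ^ b) (2 ^ i)))
    factor : C * (2 ^ (b + i)) ^ p < 2 ^ 2 ^ i
    factor = begin-strict
      C * (2 ^ (b + i)) ^ p            ≡⟨ cong (λ z → C * z ^ p) (^-distribˡ-+-* 2 b i) ⟩
      C * (2 ^ b * 2 ^ i) ^ p          ≡⟨ cong (C *_) (^-distribʳ-* (2 ^ b) (2 ^ i) p) ⟩
      C * ((2 ^ b) ^ p * (2 ^ i) ^ p)  ≡⟨ *-assoc C _ _ ⟨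
      C′ * (2 ^ i) ^ p                 ≡⟨ cong (C′ *_) (^-*-assoc 2 i p) ⟩
      C′ * 2 ^ (i * p)                 <⟨ *-monoˡ-< (2 ^ (i * p)) {{>-nonZero (m^n>0 2 (i * p))}} (n<2^n C′) ⟩
      2 ^ C′ * 2 ^ (i * p)             ≡⟨ ^-distribˡ-+-* 2 C′ (i * p) ⟨
      2 ^ (C′ + i * p)                 ≤⟨ ^-monoʳ-≤ 2 (proj₂ (2^-beats-linear C′ p)) ⟩
      2 ^ 2 ^ i                        ∎
    too-small : C * (2 ^ (b + i)) ^ p * b ^ 2 ^ (b + i) < 2 ^ 2 ^ i * b ^ 2 ^ (b + i)
    too-small = *-monoˡ-< (b ^ 2 ^ (b + i)) {{>-nonZero (m^n>0 b (2 ^ (b + i)))}} factor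

-- The two limits

^-swap : ∀ a b c → (a ^ b) ^ c ≡ (a ^ c) ^ b
^-swap a b c = trans (^-*-assoc a b c) (trans (cong (a ^_) (*-comm b c)) (≡.sym (^-*-assoc a c b)))

SidorenkoOnLists : ∀ v → List (Fin v × Fin v) → Set₁
SidorenkoOnLists v es = ∀ S → 1 ≤ order S →
  order S ^ v * arcs S ^ length es ≤ hom v es S * order S ^ (2 * length es)

1≤arcs⇒1≤order : ∀ S → 1 ≤ arcs S → 1 ≤ order S
1≤arcs⇒1≤order S le = nonempty (verts S) le
  where
  nonempty : ∀ xs → 1 ≤ ∑ xs (deg S) → 1 ≤ length xs
  nonempty (x ∷ xs) _ = s≤s z≤n

pow : ListGraph → ℕ → ListGraph
pow S zero    = S
pow S (suc j) = pow S j ⊠ pow S j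

square-power : ∀ a j → a ^ 2 ^ j * a ^ 2 ^ j ≡ a ^ 2 ^ suc j
square-power a j = trans (≡.sym (^-distribˡ-+-* a (2 ^ j) (2 ^ j)))
  (cong (λ z → a ^ (2 ^ j + z)) (≡.sym (+-identityʳ (2 ^ j))))

arcs-pow : ∀ S j → arcs (pow S j) ≡ arcs S ^ 2 ^ j
arcs-pow S zero    = ≡.sym (*-identityʳ _)
arcs-pow S (suc j) = trans (arcs-⊠ (pow S j) (pow S j))
  (trans (cong₂ _*_ (arcs-pow S j) (arcs-pow S j)) (square-power (arcs S) j))

order-pow : ∀ S j → order (pow S j) ≡ order S ^ 2 ^ j
order-pow S zero    = ≡.sym (*-identityʳ _)
order-pow S (suc j) = trans (order-⊠ (pow S j) (pow S j))
  (trans (cong₂ _*_ (order-pow S j) (order-pow S j)) (square-power (order S) j))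

ladder-pow : ∀ v es S m j → ladder v es m (pow S j) ≡ ladder v es m S ^ 2 ^ j
ladder-pow v es S m zero    = ≡.sym (*-identityʳ _)
ladder-pow v es S m (suc j) = trans (ladder-⊠ (pow S j) (pow S j) v es m)
  (trans (cong₂ _*_ (ladder-pow v es S m j) (ladder-pow v es S m j)) (square-power (ladder v es m S) j))

-- The number of homomorphisms from H □ C into S, where C is the closed walk of length 2 (n + 1).
cyclic : ∀ v → List (Fin v × Fin v) → ℕ → ListGraph → ℕ
cyclic v es n S = Ladder.tr S v es (Ladder.sq S v es (Ladder.path S v es n))

module _ {v : ℕ} {es : List (Fin v × Fin v)} (sid : SidorenkoOnLists v es) where
  private
    e = length es

  sidorenko-walks : ∀ S m → 1 ≤ ladder 1 [] m S →
    ladder 1 [] m S ^ v * ladder 2 K₂ m S ^ e ≤ ladder v es m S * ladder 1 [] m S ^ (2 * e)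
  sidorenko-walks S m 1≤ = begin
    ladder 1 [] m S ^ v * ladder 2 K₂ m S ^ e  ≡⟨ cong₂ (λ x y → x ^ v * y ^ e) order≡ arcs≡ ⟨
    order Y ^ v * arcs Y ^ e                   ≤⟨ sid Y (≤-trans 1≤ (≤-reflexive (≡.sym order≡))) ⟩
    hom v es Y * order Y ^ (2 * e)             ≡⟨ cong₂ (λ x y → x * y ^ (2 * e)) (hom-walkGraph S v es m) order≡ ⟩
    ladder v es m S * ladder 1 [] m S ^ (2 * e) ∎
    where
    open ≤-Reasoning
    Y = walkGraph S m
    order≡ : order Y ≡ ladder 1 [] m S
    order≡ = trans (≡.sym (hom-K₁ Y)) (hom-walkGraph S 1 [] m)
    arcs≡ : arcs Y ≡ ladder 2 K₂ m S
    arcs≡ = trans (≡.sym (hom-K₂ Y)) (hom-walkGraph S 2 K₂ m)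

  -- `sidorenko-walks` with every walk count on the smaller side replaced by its lower bound and the
  -- one on the larger side by `ladder-K₁-upper`. Only `order Z ^ (2 * e)` is not an m-th power
  -- apart from the ladder itself, so it disappears in the first limit.
  ladder-lower : ∀ Z {Δ} → 1 ≤ arcs Z → (∀ {z} → z ∈ verts Z → deg Z z ≤ Δ) → ∀ i →
    (arcs Z ^ v * (arcs Z ^ 4) ^ e) ^ (i + i)
      ≤ (ladder v es (i + i) Z * order Z ^ (2 * e))
        * (Δ ^ (2 * e) * (order Z ^ v * ((order Z ^ 4) ^ e * arcs Z ^ e))) ^ (i + i)
  ladder-lower Z {Δ} 1≤M deg≤Δ i = begin
    (M ^ v * (M ^ 4) ^ e) ^ m
      ≡⟨ trans (^-distribʳ-* (M ^ v) _ m) (cong₂ _*_ (^-swap M v m) (^-swap (M ^ 4) e m)) ⟩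
    (M ^ m) ^ v * ((M ^ 4) ^ m) ^ e
      ≤⟨ *-mono-≤ (^-monoˡ-≤ v M^m≤) (^-monoˡ-≤ e M⁴^m≤) ⟩
    (t₁ * N ^ m) ^ v * (t₂ * ((N ^ 4) ^ m * M ^ m)) ^ e
      ≡⟨ cong₂ _*_ (^-distribʳ-* t₁ (N ^ m) v) (trans (^-distribʳ-* t₂ _ e)
           (cong (t₂ ^ e *_) (^-distribʳ-* ((N ^ 4) ^ m) (M ^ m) e))) ⟩
    (t₁ ^ v * (N ^ m) ^ v) * (t₂ ^ e * (((N ^ 4) ^ m) ^ e * (M ^ m) ^ e))
      ≡⟨ *-interchange (t₁ ^ v) _ _ _ ⟩
    (t₁ ^ v * t₂ ^ e) * ((N ^ m) ^ v * (((N ^ 4) ^ m) ^ e * (M ^ m) ^ e))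
      ≡⟨ cong ((t₁ ^ v * t₂ ^ e) *_) R≡ ⟨
    (t₁ ^ v * t₂ ^ e) * R ^ m
      ≤⟨ *-monoˡ-≤ (R ^ m) (sidorenko-walks Z m 1≤t₁) ⟩
    (t * t₁ ^ (2 * e)) * R ^ m
      ≤⟨ *-monoˡ-≤ (R ^ m) (*-monoʳ-≤ t (^-monoˡ-≤ (2 * e) (ladder-K₁-upper Z deg≤Δ m))) ⟩
    (t * (N * Δ ^ m) ^ (2 * e)) * R ^ m
      ≡⟨ cong (λ z → (t * z) * R ^ m) (trans (^-distribʳ-* N (Δ ^ m) (2 * e))
           (cong (N ^ (2 * e) *_) (^-swap Δ m (2 * e)))) ⟩
    (t * (N ^ (2 * e) * (Δ ^ (2 * e)) ^ m)) * R ^ m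
      ≡⟨ regroup t (N ^ (2 * e)) _ _ ⟩
    (t * N ^ (2 * e)) * ((Δ ^ (2 * e)) ^ m * R ^ m)
      ≡⟨ cong ((t * N ^ (2 * e)) *_) (^-distribʳ-* (Δ ^ (2 * e)) R m) ⟨
    (t * N ^ (2 * e)) * (Δ ^ (2 * e) * R) ^ m ∎
    where
    open ≤-Reasoning
    m  = i + i
    N  = order Z
    M  = arcs Z
    t  = ladder v es m Z
    t₁ = ladder 1 [] m Z
    t₂ = ladder 2 K₂ m Z
    c  = ladder 2 K₂ 1 Z
    R  = N ^ v * ((N ^ 4) ^ e * M ^ e)
    1≤N : 1 ≤ N
    1≤N = 1≤arcs⇒1≤order Z 1≤M
    M^m≤ : M ^ m ≤ t₁ * N ^ m
    M^m≤ = ≤-trans (m≤n*m (M ^ m) N {{>-nonZero 1≤N}}) (ladder-K₁-lower Z i)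
    1≤t₁ : 1 ≤ t₁
    1≤t₁ = n≢0⇒n>0 (λ t₁≡0 → <⇒≱ (m^n>0 M {{>-nonZero 1≤M}} m)
      (≤-trans M^m≤ (≤-reflexive (cong (_* N ^ m) t₁≡0))))
    M⁴^m≤ : (M ^ 4) ^ m ≤ t₂ * ((N ^ 4) ^ m * M ^ m)
    M⁴^m≤ = begin
      (M ^ 4) ^ m                    ≤⟨ ^-monoˡ-≤ m (C₄-lower Z) ⟩
      (c * N ^ 4) ^ m                ≡⟨ ^-distribʳ-* c (N ^ 4) m ⟩
      c ^ m * (N ^ 4) ^ m            ≤⟨ *-monoˡ-≤ _ (≤-trans (m≤n*m (c ^ m) M {{>-nonZero 1≤M}}) (ladder-K₂-lower Z i)) ⟩
      (t₂ * M ^ m) * (N ^ 4) ^ m     ≡⟨ trans (*-assoc t₂ _ _) (cong (t₂ *_) (*-comm (M ^ m) _)) ⟩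
      t₂ * ((N ^ 4) ^ m * M ^ m)     ∎
    R≡ : R ^ m ≡ (N ^ m) ^ v * (((N ^ 4) ^ m) ^ e * (M ^ m) ^ e)
    R≡ = trans (^-distribʳ-* (N ^ v) _ m) (cong₂ _*_ (^-swap N v m)
      (trans (^-distribʳ-* ((N ^ 4) ^ e) (M ^ e) m) (cong₂ _*_ (^-swap (N ^ 4) e m) (^-swap M e m))))
    regroup : ∀ a b c d → (a * (b * c)) * d ≡ (a * b) * (c * d)
    regroup = solve-∀

  module _ (S : ListGraph) (n : ℕ) where
    private
      k = 2 * suc n
      a = cyclic v es n S

    -- Let the number of rungs tend to infinity.
    cyclic-lower : ∀ Z {Δ} K → 1 ≤ arcs Z → (∀ {z} → z ∈ verts Z → deg Z z ≤ Δ) →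
      (∀ m → ladder v es m Z ≤ ladder v es m S ^ K) →
      (arcs Z ^ v * (arcs Z ^ 4) ^ e) ^ k
        ≤ a ^ K * (Δ ^ (2 * e) * (order Z ^ v * ((order Z ^ 4) ^ e * arcs Z ^ e))) ^ k
    -- The surplus factor does not depend on `l`, so the polynomial degree in `root-limit` is 0.
    cyclic-lower Z {Δ} K 1≤M deg≤Δ ladder≤ = root-limit _ _ (T₀ ^ K * order Z ^ (2 * e)) 0 bound
      where
      open ≤-Reasoning
      T₀ = ladder v es 0 S
      X = arcs Z ^ v * (arcs Z ^ 4) ^ e
      Y = Δ ^ (2 * e) * (order Z ^ v * ((order Z ^ 4) ^ e * arcs Z ^ e))
      N = order Z ^ (2 * e)
      double : ∀ p s → p * s + p * s ≡ (2 * p) * s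
      double = solve-∀
      exponent : ∀ p s → (2 * s) * p ≡ p * s + p * s
      exponent = solve-∀
      regroup : ∀ t a N Y → ((t * a) * N) * Y ≡ (t * N) * 1 * (a * Y)
      regroup = solve-∀
      bound : ∀ l → (X ^ k) ^ 2 ^ l ≤ (T₀ ^ K * N) * (2 ^ l) ^ 0 * (a ^ K * Y ^ k) ^ 2 ^ l
      bound l = begin
        (X ^ k) ^ 2 ^ l
          ≡⟨ trans (^-*-assoc X k (2 ^ l)) (cong (X ^_) (exponent (2 ^ l) (suc n))) ⟩
        X ^ (i + i)
          ≤⟨ ladder-lower Z 1≤M deg≤Δ i ⟩
        (ladder v es (i + i) Z * N) * Y ^ (i + i)
          ≤⟨ *-monoˡ-≤ (Y ^ (i + i)) (*-monoˡ-≤ N (≤-trans (ladder≤ (i + i)) (^-monoˡ-≤ K ladder≤trace))) ⟩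
        ((T₀ * a ^ 2 ^ l) ^ K * N) * Y ^ (i + i)
          ≡⟨ cong₂ (λ x y → (x * N) * y)
               (trans (^-distribʳ-* T₀ _ K) (cong (T₀ ^ K *_) (^-swap a (2 ^ l) K)))
               (trans (cong (Y ^_) (≡.sym (exponent (2 ^ l) (suc n)))) (≡.sym (^-*-assoc Y k (2 ^ l)))) ⟩
        ((T₀ ^ K * (a ^ K) ^ 2 ^ l) * N) * (Y ^ k) ^ 2 ^ l
          ≡⟨ regroup (T₀ ^ K) _ N _ ⟩
        (T₀ ^ K * N) * 1 * ((a ^ K) ^ 2 ^ l * (Y ^ k) ^ 2 ^ l)
          ≡⟨ cong ((T₀ ^ K * N) * 1 *_) (^-distribʳ-* (a ^ K) (Y ^ k) (2 ^ l)) ⟨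
        (T₀ ^ K * N) * (2 ^ l) ^ 0 * (a ^ K * Y ^ k) ^ 2 ^ l ∎
        where
        i = 2 ^ l * suc n
        ladder≤trace : ladder v es (i + i) S ≤ T₀ * a ^ 2 ^ l
        ladder≤trace = ≤-trans (≤-reflexive (cong (λ m → ladder v es m S) (double (2 ^ l) (suc n))))
          (Ladder.T≤trace S v es n l)

    module _ (1≤D : 1 ≤ arcs S) where
      private
        D = arcs S
        N = order S
        d : ℕ
        d = suc D
        -- The loss `W` below contains `Q = q ^ 4` with exponent v + 4e, and `q` is at most
        -- `d * 2 ^ j`.
        p₁ = 4 * v + 16 * e
        p₀ = p₁ * k
        c₀ = (d ^ p₁ * 16 ^ e) ^ k

      -- `cyclic-lower` for a nearly regular subgraph `Z` of a tensor power. Replacing the order and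
      -- arcs of `Z` by those of the whole power costs `W ^ k`, which is polynomial in 2^j.
      cyclic-lower-pow : ∀ j → (((D ^ v * D ^ e) ^ k) ^ 2) ^ 2 ^ j
        ≤ c₀ * (2 ^ j) ^ p₀ * ((a * (N ^ v * (N ^ 2) ^ e) ^ k) ^ 2) ^ 2 ^ j
      cyclic-lower-pow j = begin
        (((D ^ v * D ^ e) ^ k) ^ 2) ^ 2 ^ j
          ≡⟨ trans (^-*-assoc _ 2 (2 ^ j)) (trans (^-swap (D ^ v * D ^ e) k K) (cong (_^ k)
               (trans (^-distribʳ-* (D ^ v) (D ^ e) K) (cong₂ _*_ (^-swap D v K) (^-swap D e K))))) ⟩
        (U ^ v * U ^ e) ^ k
          -- The three surplus factors `U` per edge of H arise on the right from (νΔ)² M and on the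
          -- left from M⁴ in place of M.
          ≤⟨ *-cancelʳ-≤ _ _ (((U ^ 3) ^ e) ^ k) {{>-nonZero (positive-power (positive-power (positive-power 1≤U 3) e) k)}} multiplied ⟩
        W ^ k * (a ^ K * (ν ^ v * (ν ^ 2) ^ e) ^ k)
          ≤⟨ *-mono-≤ W^k≤ (*-monoʳ-≤ (a ^ K) n-part) ⟩
        (c₀ * J ^ p₀) * (a ^ K * ((N ^ v * (N ^ 2) ^ e) ^ k) ^ K)
          ≡⟨ cong (c₀ * J ^ p₀ *_) (trans (≡.sym (^-distribʳ-* a _ K)) (≡.sym (^-*-assoc _ 2 (2 ^ j)))) ⟩
        c₀ * (2 ^ j) ^ p₀ * ((a * (N ^ v * (N ^ 2) ^ e) ^ k) ^ 2) ^ 2 ^ j ∎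
        where
        open ≤-Reasoning
        J = 2 ^ j
        -- `Z` lies in the tensor square of `pow S j`, which is `pow S (suc j)`.
        K = 2 ^ suc j
        -- Degrees in `pow S j` are at most D^J ≤ 2^(D J). That the number of dyadic classes is
        -- linear in `J` is what keeps the loss polynomial.
        q = suc (D * J)
        U = D ^ K
        positive-power : ∀ {x : ℕ} → 1 ≤ x → ∀ y → 1 ≤ x ^ y
        positive-power {x} 1≤x y = m^n>0 x {{>-nonZero 1≤x}} y
        1≤U : 1 ≤ U
        1≤U = positive-power 1≤D K
        1≤arcs-pow : 1 ≤ arcs (pow S j)
        1≤arcs-pow = ≤-trans (positive-power 1≤D J) (≤-reflexive (≡.sym (arcs-pow S j)))
        arcs-pow<2^q : arcs (pow S j) < 2 ^ q
        arcs-pow<2^q = begin-strict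
          arcs (pow S j)   ≡⟨ arcs-pow S j ⟩
          D ^ J            ≤⟨ ^-monoˡ-≤ J (<⇒≤ (n<2^n D)) ⟩
          (2 ^ D) ^ J      ≡⟨ ^-*-assoc 2 D J ⟩
          2 ^ (D * J)      <⟨ ^-monoʳ-< 2 (s≤s (s≤s z≤n)) (n<1+n (D * J)) ⟩
          2 ^ q            ∎
        open DegreeClasses (pow S j) q 1≤arcs-pow arcs-pow<2^q
        c = proj₁ pairClass-arcs-lower
        Z = pairClass c
        ν = order Z
        M = arcs Z
        Δ = 2 ^ (2 + c)
        Q = q ^ 4
        W = Q ^ v * (Q ^ 4) ^ e * 16 ^ e
        arcs²≡U : arcs (pow S j) * arcs (pow S j) ≡ U
        arcs²≡U = trans (≡.sym (arcs-⊠ (pow S j) (pow S j))) (arcs-pow S (suc j))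
        U≤QM : U ≤ Q * M
        U≤QM = ≤-trans (≤-reflexive (≡.sym arcs²≡U)) (proj₂ pairClass-arcs-lower)
        M≤U : M ≤ U
        M≤U = ≤-trans (pairClass-arcs-upper c) (≤-reflexive arcs²≡U)
        nΔ≤4U : ν * Δ ≤ 4 * U
        nΔ≤4U = ≤-trans (pairClass-order*deg c) (≤-reflexive (cong (4 *_) arcs²≡U))
        n≤N^K : ν ≤ N ^ K
        n≤N^K = ≤-trans (pairClass-order-upper c)
          (≤-reflexive (trans (≡.sym (order-⊠ (pow S j) (pow S j))) (order-pow S (suc j))))
        1≤M : 1 ≤ M
        1≤M = n≢0⇒n>0 (λ M≡0 → <⇒≱ 1≤U
          (≤-trans U≤QM (≤-reflexive (trans (cong (Q *_) M≡0) (*-zeroʳ Q)))))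
        main : (M ^ v * (M ^ 4) ^ e) ^ k ≤ a ^ K * (Δ ^ (2 * e) * (ν ^ v * ((ν ^ 4) ^ e * M ^ e))) ^ k
        main = cyclic-lower Z K 1≤M (pairClass-deg-upper c) (λ m →
          ≤-trans (ladder-induced (pow S (suc j)) (inPairClass? c) v es m) (≤-reflexive (ladder-pow v es S m (suc j))))
        n-part : (ν ^ v * (ν ^ 2) ^ e) ^ k ≤ ((N ^ v * (N ^ 2) ^ e) ^ k) ^ K
        n-part = begin
          (ν ^ v * (ν ^ 2) ^ e) ^ k
            ≤⟨ ^-monoˡ-≤ k (*-mono-≤ (^-monoˡ-≤ v n≤N^K) (^-monoˡ-≤ e (^-monoˡ-≤ 2 n≤N^K))) ⟩
          ((N ^ K) ^ v * ((N ^ K) ^ 2) ^ e) ^ k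
            ≡⟨ cong (_^ k) (trans (cong₂ _*_ (^-swap N K v) (trans (cong (_^ e) (^-swap N K 2)) (^-swap (N ^ 2) K e)))
                 (≡.sym (^-distribʳ-* (N ^ v) _ K))) ⟩
          ((N ^ v * (N ^ 2) ^ e) ^ K) ^ k
            ≡⟨ ^-swap _ K k ⟩
          ((N ^ v * (N ^ 2) ^ e) ^ k) ^ K ∎
        U-part : U ^ v * (U ^ 4) ^ e ≤ (Q ^ v * (Q ^ 4) ^ e) * (M ^ v * (M ^ 4) ^ e)
        U-part = begin
          U ^ v * (U ^ 4) ^ e
            ≤⟨ *-mono-≤ (^-monoˡ-≤ v U≤QM) (^-monoˡ-≤ e (^-monoˡ-≤ 4 U≤QM)) ⟩
          (Q * M) ^ v * ((Q * M) ^ 4) ^ e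
            ≡⟨ cong₂ _*_ (^-distribʳ-* Q M v) (trans (cong (_^ e) (^-distribʳ-* Q M 4)) (^-distribʳ-* (Q ^ 4) (M ^ 4) e)) ⟩
          (Q ^ v * M ^ v) * ((Q ^ 4) ^ e * (M ^ 4) ^ e)
            ≡⟨ *-interchange (Q ^ v) _ _ _ ⟩
          (Q ^ v * (Q ^ 4) ^ e) * (M ^ v * (M ^ 4) ^ e) ∎
        -- Near-regularity is spent here: two of the four factors ν per edge absorb Δ² through ν Δ ≤
        -- 4 U, which leaves the exponent 2 that Sidorenko's inequality wants and the constant 16.
        Δ-part : Δ ^ (2 * e) * (ν ^ v * ((ν ^ 4) ^ e * M ^ e))
          ≤ (ν ^ v * (ν ^ 2) ^ e) * (16 ^ e * (U ^ 3) ^ e)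
        Δ-part = begin
          Δ ^ (2 * e) * (ν ^ v * ((ν ^ 4) ^ e * M ^ e))
            ≡⟨ cong₂ (λ x y → x * (ν ^ v * (y * M ^ e))) (≡.sym (^-*-assoc Δ 2 e))
                 (trans (cong (_^ e) (^-distribˡ-+-* ν 2 2)) (^-distribʳ-* (ν ^ 2) (ν ^ 2) e)) ⟩
          (Δ ^ 2) ^ e * (ν ^ v * (((ν ^ 2) ^ e * (ν ^ 2) ^ e) * M ^ e))
            ≡⟨ regroup ((Δ ^ 2) ^ e) (ν ^ v) ((ν ^ 2) ^ e) (M ^ e) ⟩
          (ν ^ v * (ν ^ 2) ^ e) * (((ν ^ 2) ^ e * (Δ ^ 2) ^ e) * M ^ e)
            ≡⟨ cong (λ x → (ν ^ v * (ν ^ 2) ^ e) * (x * M ^ e))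
                 (trans (≡.sym (^-distribʳ-* (ν ^ 2) (Δ ^ 2) e)) (cong (_^ e) (≡.sym (^-distribʳ-* ν Δ 2)))) ⟩
          (ν ^ v * (ν ^ 2) ^ e) * (((ν * Δ) ^ 2) ^ e * M ^ e)
            ≤⟨ *-monoʳ-≤ (ν ^ v * (ν ^ 2) ^ e)
                 (*-mono-≤ (^-monoˡ-≤ e (^-monoˡ-≤ 2 nΔ≤4U)) (^-monoˡ-≤ e M≤U)) ⟩
          (ν ^ v * (ν ^ 2) ^ e) * (((4 * U) ^ 2) ^ e * U ^ e)
            ≡⟨ cong ((ν ^ v * (ν ^ 2) ^ e) *_) (trans (≡.sym (^-distribʳ-* ((4 * U) ^ 2) U e))
                 (trans (cong (_^ e) (sixteen U)) (^-distribʳ-* 16 (U ^ 3) e))) ⟩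
          (ν ^ v * (ν ^ 2) ^ e) * (16 ^ e * (U ^ 3) ^ e) ∎
          where
          regroup : ∀ x y z w → x * (y * ((z * z) * w)) ≡ (y * z) * ((z * x) * w)
          regroup = solve-∀
          sixteen : ∀ x → ((4 * x) * ((4 * x) * 1)) * x ≡ 16 * (x * (x * (x * 1)))
          sixteen = solve-∀
        multiplied : (U ^ v * U ^ e) ^ k * ((U ^ 3) ^ e) ^ k
          ≤ (W ^ k * (a ^ K * (ν ^ v * (ν ^ 2) ^ e) ^ k)) * ((U ^ 3) ^ e) ^ k
        multiplied = begin
          (U ^ v * U ^ e) ^ k * ((U ^ 3) ^ e) ^ k
            ≡⟨ trans (≡.sym (^-distribʳ-* (U ^ v * U ^ e) _ k)) (cong (_^ k)
                 (trans (*-assoc (U ^ v) _ _) (cong (U ^ v *_) (≡.sym (^-distribʳ-* U (U ^ 3) e))))) ⟩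
          (U ^ v * (U ^ 4) ^ e) ^ k
            ≤⟨ ^-monoˡ-≤ k U-part ⟩
          ((Q ^ v * (Q ^ 4) ^ e) * (M ^ v * (M ^ 4) ^ e)) ^ k
            ≡⟨ ^-distribʳ-* (Q ^ v * (Q ^ 4) ^ e) _ k ⟩
          (Q ^ v * (Q ^ 4) ^ e) ^ k * (M ^ v * (M ^ 4) ^ e) ^ k
            ≤⟨ *-monoʳ-≤ ((Q ^ v * (Q ^ 4) ^ e) ^ k) (≤-trans main (*-monoʳ-≤ (a ^ K) (^-monoˡ-≤ k Δ-part))) ⟩
          (Q ^ v * (Q ^ 4) ^ e) ^ k * (a ^ K * ((ν ^ v * (ν ^ 2) ^ e) * (16 ^ e * (U ^ 3) ^ e)) ^ k)
            ≡⟨ cong (λ x → (Q ^ v * (Q ^ 4) ^ e) ^ k * (a ^ K * x))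
                 (trans (^-distribʳ-* (ν ^ v * (ν ^ 2) ^ e) _ k)
                   (cong ((ν ^ v * (ν ^ 2) ^ e) ^ k *_) (^-distribʳ-* (16 ^ e) _ k))) ⟩
          (Q ^ v * (Q ^ 4) ^ e) ^ k * (a ^ K * ((ν ^ v * (ν ^ 2) ^ e) ^ k * ((16 ^ e) ^ k * ((U ^ 3) ^ e) ^ k)))
            ≡⟨ regroup ((Q ^ v * (Q ^ 4) ^ e) ^ k) (a ^ K) ((ν ^ v * (ν ^ 2) ^ e) ^ k) ((16 ^ e) ^ k) (((U ^ 3) ^ e) ^ k) ⟩
          (((Q ^ v * (Q ^ 4) ^ e) ^ k * (16 ^ e) ^ k) * (a ^ K * (ν ^ v * (ν ^ 2) ^ e) ^ k)) * ((U ^ 3) ^ e) ^ k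
            ≡⟨ cong (λ x → (x * (a ^ K * (ν ^ v * (ν ^ 2) ^ e) ^ k)) * ((U ^ 3) ^ e) ^ k)
                 (^-distribʳ-* (Q ^ v * (Q ^ 4) ^ e) (16 ^ e) k) ⟨
          (W ^ k * (a ^ K * (ν ^ v * (ν ^ 2) ^ e) ^ k)) * ((U ^ 3) ^ e) ^ k ∎
          where
          regroup : ∀ x y z w u → x * (y * (z * (w * u))) ≡ ((x * w) * (y * z)) * u
          regroup = solve-∀
        q≤dJ : q ≤ d * J
        q≤dJ = +-monoˡ-≤ (D * J) (m^n>0 2 j)
        Q-power : Q ^ v * (Q ^ 4) ^ e ≡ q ^ p₁
        Q-power = trans
          (cong₂ _*_ (^-*-assoc q 4 v) (trans (cong (_^ e) (^-*-assoc q 4 4)) (^-*-assoc q 16 e)))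
          (≡.sym (^-distribˡ-+-* q (4 * v) (16 * e)))
        regroup-W : ∀ x y z → (x * y) * z ≡ (x * z) * y
        regroup-W = solve-∀
        W^k≤ : W ^ k ≤ c₀ * J ^ p₀
        W^k≤ = begin
          W ^ k                             ≡⟨ cong (λ x → (x * 16 ^ e) ^ k) Q-power ⟩
          (q ^ p₁ * 16 ^ e) ^ k             ≤⟨ ^-monoˡ-≤ k (*-monoˡ-≤ (16 ^ e) (^-monoˡ-≤ p₁ q≤dJ)) ⟩
          ((d * J) ^ p₁ * 16 ^ e) ^ k       ≡⟨ cong (λ x → (x * 16 ^ e) ^ k) (^-distribʳ-* d J p₁) ⟩
          ((d ^ p₁ * J ^ p₁) * 16 ^ e) ^ k  ≡⟨ cong (_^ k) (regroup-W (d ^ p₁) (J ^ p₁) (16 ^ e)) ⟩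
          ((d ^ p₁ * 16 ^ e) * J ^ p₁) ^ k  ≡⟨ ^-distribʳ-* (d ^ p₁ * 16 ^ e) (J ^ p₁) k ⟩
          c₀ * (J ^ p₁) ^ k                 ≡⟨ cong (c₀ *_) (^-*-assoc J p₁ k) ⟩
          c₀ * J ^ p₀                       ∎

      -- Let the tensor power tend to infinity.
      cyclic-sidorenko : (D ^ v * D ^ e) ^ k ≤ a * (N ^ v * (N ^ 2) ^ e) ^ k
      cyclic-sidorenko = ^-cancelˡ-≤-2 ((D ^ v * D ^ e) ^ k) (a * (N ^ v * (N ^ 2) ^ e) ^ k)
        (root-limit _ _ c₀ p₀ cyclic-lower-pow)
        where
        ^-cancelˡ-≤-2 : ∀ x y → x ^ 2 ≤ y ^ 2 → x ≤ y
        ^-cancelˡ-≤-2 x y le = m²≤n²⇒m≤n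
          (≡.subst₂ _≤_ (cong (x *_) (*-identityʳ x)) (cong (y *_) (*-identityʳ y)) le)

-- Back to graphs

bit : Bool → ℕ
bit true  = 1
bit false = 0

bit-01 : ∀ b → Is01 (bit b)
bit-01 true  = inj₂ refl
bit-01 false = inj₁ refl

bit≡1⇒true : ∀ {b} → bit b ≡ 1 → b ≡ true
bit≡1⇒true {true} _ = refl

does≡true⇒ : ∀ {P : Set} (d : Dec P) → does d ≡ true → P
does≡true⇒ (yes p) _ = p

toListGraph : Graph → ListGraph
toListGraph G = record
  { Vertex     = Fin (Graph.n G)
  ; verts      = allFin (Graph.n G)
  ; rel        = λ i j → bit (adj G i j)
  ; rel-sym    = λ i j → cong bit (Graph.sym G i j)
  ; rel-01     = λ i j → bit-01 (adj G i j)
  ; rel-irrefl = λ i → cong bit (Graph.irrefl G i)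
  }

order-toListGraph : ∀ G → order (toListGraph G) ≡ ∣V∣ G
order-toListGraph G = List.length-tabulate id

arcs≤order² : ∀ S → arcs S ≤ order S * order S
arcs≤order² S = begin
  arcs S                                          ≤⟨ ∑-mono V (λ x → ∑-mono V (λ y → rel≤1 (rel-01 S x y))) ⟩
  ∑ V (λ _ → ∑ V (λ _ → 1))                       ≡⟨ ∑-const V _ ⟩
  order S * ∑ V (λ _ → 1)                         ≡⟨ cong (order S *_) (trans (∑-const V 1) (*-identityʳ _)) ⟩
  order S * order S                               ∎
  where
  open ≤-Reasoning
  V = verts S
  rel≤1 : ∀ {m} → Is01 m → m ≤ 1
  rel≤1 (inj₁ refl) = z≤n
  rel≤1 (inj₂ refl) = ≤-refl

module _ (G : Graph) where
  private
    V = allFin (Graph.n G)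

  isEdge? : (p : Fin (Graph.n G) × Fin (Graph.n G)) →
    Dec (toℕ (proj₁ p) < toℕ (proj₂ p) × adj G (proj₁ p) (proj₂ p) ≡ true)
  isEdge? (i , j) = (toℕ i <? toℕ j) ×-dec (adj G i j ≟ᵇ true)

  edges : List (Fin (Graph.n G) × Fin (Graph.n G))
  edges = filter isEdge? (concatMap (λ i → map (i ,_) V) V)

  ∈-edges⁺ : ∀ {i j} → toℕ i < toℕ j → adj G i j ≡ true → (i , j) ∈ edges
  ∈-edges⁺ {i} {j} i<j i~j = ∈-filter⁺ isEdge?
    (∈-concatMap⁺ (λ i → map (i ,_) V) (Any.map (λ { refl → ∈-map⁺ (i ,_) (∈-allFin j) }) (∈-allFin i)))
    (i<j , i~j)

  ∈-edges⁻ : ∀ {i j} → (i , j) ∈ edges → adj G i j ≡ true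
  ∈-edges⁻ p∈ = proj₂ (proj₂ (∈-filter⁻ isEdge? {xs = concatMap (λ i → map (i ,_) V) V} p∈))

  2∣E∣≡arcs : 2 * ∣E∣ G ≡ arcs (toListGraph G)
  2∣E∣≡arcs = begin
    2 * length edges                                                    ≡⟨ cong (2 *_) (length-filter isEdge? (concatMap (λ i → map (i ,_) V) V)) ⟩
    2 * ∑ (concatMap (λ i → map (i ,_) V) V) (λ p → [[ isEdge? p ]])    ≡⟨ cong (2 *_) (∑-concatMap-map _,_ V V) ⟩
    2 * S                                                               ≡⟨ cong (S +_) (trans (+-identityʳ S) (∑-swap V V)) ⟩
    S + ∑ V (λ i → ∑ V (λ j → [[ isEdge? (j , i) ]]))                   ≡⟨ trans (∑-cong V (λ i → ∑-+ V)) (∑-+ V) ⟨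
    ∑ V (λ i → ∑ V (λ j → [[ isEdge? (i , j) ]] + [[ isEdge? (j , i) ]])) ≡⟨ ∑-cong V (λ i → ∑-cong V (λ j → orient i j _ refl)) ⟩
    arcs (toListGraph G) ∎
    where
    open ≡-Reasoning
    S = ∑ V (λ i → ∑ V (λ j → [[ isEdge? (i , j) ]]))
    orient : ∀ i j b → adj G i j ≡ b → [[ isEdge? (i , j) ]] + [[ isEdge? (j , i) ]] ≡ bit b
    orient i j false i≁j = cong₂ _+_
      ([[ isEdge? (i , j) ]]-no (λ (_ , i~j) → case trans (≡.sym i≁j) i~j of λ ()))
      ([[ isEdge? (j , i) ]]-no (λ (_ , j~i) → case trans (≡.sym i≁j) (trans (Graph.sym G i j) j~i) of λ ()))
    orient i j true i~j with <-cmp (toℕ i) (toℕ j)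
    ... | tri< i<j _ j≮i = cong₂ _+_ ([[ isEdge? (i , j) ]]-yes (i<j , i~j)) ([[ isEdge? (j , i) ]]-no (λ (lt , _) → j≮i lt))
    ... | tri> i≮j _ j<i = cong₂ _+_ ([[ isEdge? (i , j) ]]-no (λ (lt , _) → i≮j lt))
                                     ([[ isEdge? (j , i) ]]-yes (j<i , trans (Graph.sym G j i) i~j))
    ... | tri≈ _ i≡j _   = case trans (≡.sym i~j)
      (subst (λ j → adj G i j ≡ false) (toℕ-injective i≡j) (Graph.irrefl G i)) of λ ()

-- The summand factors through `Vec.tabulate`, since functions that agree pointwise need not be
-- equal. `allFuns` varies the first value innermost and `vecs` outermost, whence the exchange of
-- sums.
∑-allFuns : ∀ v m (φ : Vec (Fin m) v → ℕ) → ∑ (allFuns v m) (φ ∘ Vec.tabulate) ≡ ∑ (vecs v (allFin m)) φ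
∑-allFuns zero    m φ = refl
∑-allFuns (suc v) m φ = begin
  ∑ (allFuns (suc v) m) (φ ∘ Vec.tabulate)
    ≡⟨ ∑-concatMap _ (allFuns v m) ⟩
  ∑ (allFuns v m) (λ f → ∑ (map _ (allFin m)) (φ ∘ Vec.tabulate))
    ≡⟨ ∑-cong (allFuns v m) (λ f → ∑-map _ (allFin m)) ⟩
  ∑ (allFuns v m) (λ f → ∑ (allFin m) (λ x → φ (x ∷ Vec.tabulate f)))
    ≡⟨ ∑-swap (allFuns v m) (allFin m) ⟩
  ∑ (allFin m) (λ x → ∑ (allFuns v m) (λ f → φ (x ∷ Vec.tabulate f)))
    ≡⟨ ∑-cong (allFin m) (λ x → ∑-allFuns v m (λ h → φ (x ∷ h))) ⟩
  ∑ (allFin m) (λ x → ∑ (vecs v (allFin m)) (λ h → φ (x ∷ h)))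
    ≡⟨ ∑-vecs-suc v (allFin m) ⟨
  ∑ (vecs (suc v) (allFin m)) φ ∎
  where open ≡-Reasoning

module _ (H G : Graph) where

  homCount≡∑ : homCount H G ≡ ∑ (vecs (Graph.n H) (allFin (Graph.n G))) (λ h → [[ isHom? H G (lookup h) ]])
  homCount≡∑ = trans (length-filter (isHom? H G) (allFuns (Graph.n H) (Graph.n G)))
    (trans (∑-cong (allFuns (Graph.n H) (Graph.n G)) (λ f →
      [[]]-cong (isHom? H G f) (isHom? H G (lookup (Vec.tabulate f)))
        (λ hom i j i~j → trans (cong₂ (adj G) (lookup∘tabulate f i) (lookup∘tabulate f j)) (hom i j i~j))
        (λ hom i j i~j → trans (≡.sym (cong₂ (adj G) (lookup∘tabulate f i) (lookup∘tabulate f j))) (hom i j i~j))))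
      (∑-allFuns (Graph.n H) (Graph.n G) (λ h → [[ isHom? H G (lookup h) ]])))

  -- A homomorphism has weight 1 on the listed edges, so the lower bound given by Sidorenko's
  -- property passes to the weighted count.
  homCount≤hom : homCount H G ≤ hom (Graph.n H) (edges H) (toListGraph G)
  homCount≤hom = ≤-trans (≤-reflexive homCount≡∑) (∑-mono (vecs (Graph.n H) (allFin (Graph.n G))) bound)
    where
    E≡1 : ∀ {h} → IsHom H G (lookup h) → ∀ es → (∀ {i j} → (i , j) ∈ es → adj H i j ≡ true) →
      E es (rel (toListGraph G)) h ≡ 1
    E≡1 hom []             es~ = refl
    E≡1 hom ((i , j) ∷ es) es~ = cong₂ _*_ (cong bit (hom i j (es~ (here refl)))) (E≡1 hom es (λ p∈ → es~ (there p∈)))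
    bound : ∀ h → [[ isHom? H G (lookup h) ]] ≤ E (edges H) (rel (toListGraph G)) h
    bound h with isHom? H G (lookup h)
    ... | yes hom = ≤-reflexive (≡.sym (E≡1 hom (edges H) (∈-edges⁻ H)))
    ... | no  _   = z≤n

∑-lookup : ∀ (xs : List A) {φ : A → ℕ} → ∑ (allFin (length xs)) (φ ∘ Data.List.lookup xs) ≡ ∑ xs φ
∑-lookup []       = refl
∑-lookup (x ∷ xs) {φ} = cong (φ x +_) (trans
  (trans (cong (λ is → ∑ is (φ ∘ Data.List.lookup (x ∷ xs))) (≡.sym (List.map-tabulate id suc)))
         (∑-map suc (allFin (length xs))))
  (∑-lookup xs))

toGraph : ListGraph → Graph
toGraph S = record
  { n      = order S
  ; adj    = λ i j → does (rel S (Data.List.lookup (verts S) i) (Data.List.lookup (verts S) j) ≟ 1)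
  ; sym    = λ i j → cong (λ r → does (r ≟ 1)) (rel-sym S _ _)
  ; irrefl = λ i → cong (λ r → does (r ≟ 1)) (rel-irrefl S _)
  }

bit-does-≟1 : ∀ {r} → Is01 r → bit (does (r ≟ 1)) ≡ r
bit-does-≟1 (inj₁ refl) = refl
bit-does-≟1 (inj₂ refl) = refl

module _ (S : ListGraph) where
  private
    at = Data.List.lookup (verts S)

  rel-toGraph : ∀ i j → rel (toListGraph (toGraph S)) i j ≡ rel S (at i) (at j)
  rel-toGraph i j = bit-does-≟1 (rel-01 S (at i) (at j))

  arcs-toGraph : arcs (toListGraph (toGraph S)) ≡ arcs S
  arcs-toGraph = trans
    (∑-cong (allFin (order S)) (λ i → trans (∑-cong (allFin (order S)) (rel-toGraph i)) (∑-lookup (verts S))))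
    (∑-lookup (verts S))

  hom-toGraph : ∀ v es → hom v es (toListGraph (toGraph S)) ≡ hom v es S
  hom-toGraph v es = trans
    (∑-cong (vecs v (allFin (order S))) (E-at es))
    (≡.sym (∑-vecs-map v at (allFin (order S)) (verts S) (λ φ → ≡.sym (∑-lookup (verts S)))))
    where
    E-at : ∀ es h → E es (rel (toListGraph (toGraph S))) h ≡ E es (rel S) (Vec.map at h)
    E-at []             h = refl
    E-at ((i , j) ∷ es) h = cong₂ _*_
      (trans (rel-toGraph (lookup h i) (lookup h j)) (≡.sym (cong₂ (rel S) (lookup-map i at h) (lookup-map j at h))))
      (E-at es h)

sidorenkoOnLists : ∀ H → Sidorenko H → SidorenkoOnLists (∣V∣ H) (edges H)
sidorenkoOnLists H sid S 1≤n = begin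
  order S ^ ∣V∣ H * arcs S ^ e                    ≡⟨ cong (λ z → order S ^ ∣V∣ H * z ^ e) (trans (2∣E∣≡arcs Y) (arcs-toGraph S)) ⟨
  order S ^ ∣V∣ H * (2 * ∣E∣ Y) ^ e               ≤⟨ sid Y 1≤n ⟩
  homCount H Y * order S ^ (2 * e)                ≤⟨ *-monoˡ-≤ (order S ^ (2 * e)) (homCount≤hom H Y) ⟩
  hom (∣V∣ H) (edges H) (toListGraph Y) * order S ^ (2 * e) ≡⟨ cong (_* order S ^ (2 * e)) (hom-toGraph S (∣V∣ H) (edges H)) ⟩
  hom (∣V∣ H) (edges H) S * order S ^ (2 * e)     ∎
  where
  open ≤-Reasoning
  Y = toGraph S
  e = length (edges H)

-- Closed walks as homomorphisms from a product with a cycle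

∑-vecs-++ : ∀ c m (xs : List A) {φ : Vec A (c + m) → ℕ} →
  ∑ (vecs (c + m) xs) φ ≡ ∑ (vecs c xs) (λ f → ∑ (vecs m xs) (λ g → φ (f Vec.++ g)))
∑-vecs-++ zero    m xs = ≡.sym (+-identityʳ _)
∑-vecs-++ (suc c) m xs = trans (∑-vecs-suc (c + m) xs)
  (trans (∑-cong xs (λ x → ∑-vecs-++ c m xs)) (≡.sym (∑-vecs-suc c xs)))

∑-vecs-concat : ∀ v c (xs : List A) {φ : Vec A (v * c) → ℕ} →
  ∑ (vecs (v * c) xs) φ ≡ ∑ (vecs v (vecs c xs)) (φ ∘ concat)
∑-vecs-concat zero    c xs = refl
∑-vecs-concat (suc v) c xs = trans (∑-vecs-++ c (v * c) xs)
  (trans (∑-cong (vecs c xs) (λ f → ∑-vecs-concat v c xs)) (≡.sym (∑-vecs-suc v (vecs c xs))))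

transpose : ∀ {v c} → Vec (Vec A v) c → Vec (Vec A c) v
transpose {v = v} []      = replicate v []
transpose         (f ∷ F) = zipWith _∷_ f (transpose F)

lookup-transpose : ∀ {v c} (F : Vec (Vec A v) c) i j → lookup (lookup (transpose F) i) j ≡ lookup (lookup F j) i
lookup-transpose (f ∷ F) i zero    = cong (λ w → lookup w zero) (lookup-zipWith _∷_ i f (transpose F))
lookup-transpose (f ∷ F) i (suc j) = trans
  (cong (λ w → lookup w (suc j)) (lookup-zipWith _∷_ i f (transpose F)))
  (lookup-transpose F i j)

∑-vecs-[[]] : ∀ v {φ : Vec (Vec A 0) v → ℕ} → ∑ (vecs v ([] ∷ [])) φ ≡ φ (replicate v [])
∑-vecs-[[]] zero    = +-identityʳ _
∑-vecs-[[]] (suc v) = trans (∑-vecs-suc v ([] ∷ [])) (trans (+-identityʳ _) (∑-vecs-[[]] v))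

∑-vecs-transpose : ∀ v c (xs : List A) {φ : Vec (Vec A c) v → ℕ} →
  ∑ (vecs v (vecs c xs)) φ ≡ ∑ (vecs c (vecs v xs)) (φ ∘ transpose)
∑-vecs-transpose v zero    xs = trans (∑-vecs-[[]] v) (≡.sym (+-identityʳ _))
∑-vecs-transpose v (suc c) xs = trans
  (∑-vecs-zipWith v _∷_ xs (vecs c xs) (vecs (suc c) xs) (λ φ → ∑-vecs-suc c xs))
  (trans (∑-cong (vecs v xs) (λ f → ∑-vecs-transpose v c xs)) (≡.sym (∑-vecs-suc c (vecs v xs))))

module ClosedWalks (X : Set) (xs : List X) (μ : X → ℕ) (K : X → X → ℕ) where
  open Kernel X xs μ K

  -- The weight of a walk with prescribed inner points. The end points carry no `μ`, so that
  -- `closed` counts the weight of each point once.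
  via : ∀ {m} → X → Vec X m → X → ℕ
  via f []       g = K f g
  via f (h ∷ hs) g = μ h * (K f h * via h hs g)

  path≡∑via : ∀ m f g → path m f g ≡ ∑ (vecs m xs) (λ hs → via f hs g)
  path≡∑via zero    f g = ≡.sym (+-identityʳ _)
  path≡∑via (suc m) f g = begin
    ∑ xs (λ h → μ h * (K f h * path m h g))
      ≡⟨ ∑-cong xs (λ h → trans (≡.sym (*-assoc (μ h) (K f h) _)) (trans
           (cong ((μ h * K f h) *_) (path≡∑via m h g)) (≡.sym (∑-*ˡ (vecs m xs) (μ h * K f h))))) ⟩
    ∑ xs (λ h → ∑ (vecs m xs) (λ hs → (μ h * K f h) * via h hs g))
      ≡⟨ ∑-cong xs (λ h → ∑-cong (vecs m xs) (λ hs → *-assoc (μ h) (K f h) (via h hs g))) ⟩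
    ∑ xs (λ h → ∑ (vecs m xs) (λ hs → via f (h ∷ hs) g))
      ≡⟨ ∑-vecs-suc m xs ⟨
    ∑ (vecs (suc m) xs) (λ hs → via f hs g) ∎
    where open ≡-Reasoning

  closed : ∀ {m} → Vec X (suc m) → ℕ
  closed (f ∷ hs) = μ f * via f hs f

  tr-path : ∀ m → tr (path m) ≡ ∑ (vecs (suc m) xs) closed
  tr-path m = trans
    (∑-cong xs (λ f → trans (cong (μ f *_) (path≡∑via m f f)) (≡.sym (∑-*ˡ (vecs m xs) (μ f)))))
    (≡.sym (∑-vecs-suc m xs))

  module _ (μ-01 : ∀ f → Is01 (μ f)) (K-01 : ∀ f g → Is01 (K f g)) where

    via-01 : ∀ {m} f (hs : Vec X m) g → Is01 (via f hs g)
    via-01 f []       g = K-01 f g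
    via-01 f (h ∷ hs) g = *-01 (μ-01 h) (*-01 (K-01 f h) (via-01 h hs g))

    closed-01 : ∀ {m} (F : Vec X (suc m)) → Is01 (closed F)
    closed-01 (f ∷ hs) = *-01 (μ-01 f) (via-01 f hs f)

  via≡1⇒μ≡1 : ∀ {m} f (hs : Vec X m) g → via f hs g ≡ 1 → ∀ i → μ (lookup hs i) ≡ 1
  via≡1⇒μ≡1 f (h ∷ hs) g eq zero    = m*n≡1⇒m≡1 (μ h) _ eq
  via≡1⇒μ≡1 f (h ∷ hs) g eq (suc i) =
    via≡1⇒μ≡1 h hs g (m*n≡1⇒n≡1 (K f h) _ (m*n≡1⇒n≡1 (μ h) _ eq)) i

  via≡1⇒K≡1 : ∀ {m} f (hs : Vec X m) g → via f hs g ≡ 1 →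
    ∀ i → K (lookup (f ∷ hs) i) (lookup (hs ∷ʳ g) i) ≡ 1
  via≡1⇒K≡1 f []       g eq zero    = eq
  via≡1⇒K≡1 f (h ∷ hs) g eq zero    = m*n≡1⇒m≡1 (K f h) _ (m*n≡1⇒n≡1 (μ h) _ eq)
  via≡1⇒K≡1 f (h ∷ hs) g eq (suc i) =
    via≡1⇒K≡1 h hs g (m*n≡1⇒n≡1 (K f h) _ (m*n≡1⇒n≡1 (μ h) _ eq)) i

  closed≡1⇒μ≡1 : ∀ {m} (F : Vec X (suc m)) → closed F ≡ 1 → ∀ i → μ (lookup F i) ≡ 1
  closed≡1⇒μ≡1 (f ∷ hs) eq zero    = m*n≡1⇒m≡1 (μ f) _ eq
  closed≡1⇒μ≡1 (f ∷ hs) eq (suc i) = via≡1⇒μ≡1 f hs f (m*n≡1⇒n≡1 (μ f) _ eq) i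

  lookup-∷ʳ-< : ∀ {m} (hs : Vec X m) g (i : Fin (suc m)) (j : Fin m) → toℕ i ≡ toℕ j →
    lookup (hs ∷ʳ g) i ≡ lookup hs j
  lookup-∷ʳ-< (h ∷ hs) g zero    zero    eq = refl
  lookup-∷ʳ-< (h ∷ hs) g (suc i) (suc j) eq = lookup-∷ʳ-< hs g i j (suc-injective eq)

  lookup-∷ʳ-last : ∀ {m} (hs : Vec X m) g (i : Fin (suc m)) → toℕ i ≡ m → lookup (hs ∷ʳ g) i ≡ g
  lookup-∷ʳ-last []       g zero    eq = refl
  lookup-∷ʳ-last (h ∷ hs) g (suc i) eq = lookup-∷ʳ-last hs g i (suc-injective eq)

  -- `hs ∷ʳ f` is the cyclic shift of `f ∷ hs`: its entry at `i` is the entry of the closed walk at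
  -- i + 1 modulo the length.
  closed≡1⇒K≡1 : ∀ {m} (F : Vec X (suc m)) → closed F ≡ 1 →
    ∀ i j → suc (toℕ i) % suc m ≡ toℕ j → K (lookup F i) (lookup F j) ≡ 1
  closed≡1⇒K≡1 {m} (f ∷ hs) eq i j step =
    trans (cong (K (lookup (f ∷ hs) i)) (≡.sym (next j step)))
          (via≡1⇒K≡1 f hs f (m*n≡1⇒n≡1 (μ f) _ eq) i)
    where
    next : ∀ j → suc (toℕ i) % suc m ≡ toℕ j → lookup (hs ∷ʳ f) i ≡ lookup (f ∷ hs) j
    next j step with m≤n⇒m<n∨m≡n (toℕ<n i)
    next zero    step | inj₁ i<m = case trans (≡.sym (m<n⇒m%n≡m i<m)) step of λ ()
    next (suc j) step | inj₁ i<m =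
      lookup-∷ʳ-< hs f i j (suc-injective (trans (≡.sym (m<n⇒m%n≡m i<m)) step))
    next zero    step | inj₂ i≡m = lookup-∷ʳ-last hs f i (suc-injective i≡m)
    next (suc j) step | inj₂ i≡m =
      case trans (≡.sym (n%n≡0 (suc m))) (trans (cong (_% suc m) (≡.sym i≡m)) step) of λ ()

-- The proof of `NonZero` is an irrelevant argument of `%`, so any instance gives the remainder used
-- inside `cycleAdj`.
cycleAdj⇒step : ∀ m (3≤m : 3 ≤ m) .{{_ : NonZero m}} i j → cycleAdj m 3≤m i j ≡ true →
  suc (toℕ i) % m ≡ toℕ j ⊎ suc (toℕ j) % m ≡ toℕ i
cycleAdj⇒step m 3≤m i j i~j = split (suc (toℕ i) % m ≟ toℕ j) (suc (toℕ j) % m ≟ toℕ i) i~j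
  where
  split : ∀ {P Q : Set} (d : Dec P) (d′ : Dec Q) → does d ∨ does d′ ≡ true → P ⊎ Q
  split (yes p) d′      _ = inj₁ p
  split (no _)  (yes q) _ = inj₂ q

module _ (H G : Graph) (n : ℕ) (3≤m : 3 ≤ 2 * suc n) where
  private
    -- `suc c′` is what `2 * suc n` reduces to; this form exposes the constructor that `closed` and
    -- `tr-path` require.
    c′ : ℕ
    c′ = n + 1 * suc n
    c : ℕ
    c = suc c′
    Cₘ = cycleGraph c 3≤m
    v = ∣V∣ H
    S = toListGraph G
    xs = vecs v (allFin (∣V∣ G))
    r = rel S
    open ClosedWalks (Vec (Fin (∣V∣ G)) v) xs (E (edges H) r) (cross r)

    E-01 : ∀ es (f : Vec (Fin (∣V∣ G)) v) → Is01 (E es r f)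
    E-01 []             f = inj₂ refl
    E-01 ((a , b) ∷ es) f = *-01 (rel-01 S _ _) (E-01 es f)

    E≡1⇒edge : ∀ es (f : Vec (Fin (∣V∣ G)) v) → E es r f ≡ 1 → ∀ {a b} → (a , b) ∈ es →
      adj G (lookup f a) (lookup f b) ≡ true
    E≡1⇒edge ((a , b) ∷ es) f eq (here refl) = bit≡1⇒true (m*n≡1⇒m≡1 (r (lookup f a) (lookup f b)) _ eq)
    E≡1⇒edge ((a , b) ∷ es) f eq (there p∈)  = E≡1⇒edge es f (m*n≡1⇒n≡1 (r (lookup f a) (lookup f b)) _ eq) p∈

    E≡1⇒hom : ∀ f → E (edges H) r f ≡ 1 → IsHom H G (lookup f)
    E≡1⇒hom f eq a b a~b with <-cmp (toℕ a) (toℕ b)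
    ... | tri< a<b _ _ = E≡1⇒edge (edges H) f eq (∈-edges⁺ H a<b a~b)
    ... | tri> _ _ b<a = trans (Graph.sym G _ _)
      (E≡1⇒edge (edges H) f eq (∈-edges⁺ H b<a (trans (Graph.sym H b a) a~b)))
    ... | tri≈ _ a≡b _ = case trans (≡.sym a~b)
      (subst (λ b → adj H a b ≡ false) (toℕ-injective a≡b) (Graph.irrefl H a)) of λ ()

    cross≡1⇒edge : ∀ {v} (f g : Vec (Fin (∣V∣ G)) v) → cross r f g ≡ 1 →
      ∀ a → adj G (lookup f a) (lookup g a) ≡ true
    cross≡1⇒edge (x ∷ f) (y ∷ g) eq zero    = bit≡1⇒true (m*n≡1⇒m≡1 (r x y) _ eq)
    cross≡1⇒edge (x ∷ f) (y ∷ g) eq (suc a) = cross≡1⇒edge f g (m*n≡1⇒n≡1 (r x y) _ eq) a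

    -- A closed walk lists one map on H for each cycle vertex, whereas the product numbers (x, i)
    -- with x as the leading coordinate; hence the transpose before `concat`.
    lookup-assembled : ∀ (F : Vec (Vec (Fin (∣V∣ G)) v) c) u →
      lookup (concat (transpose F)) u ≡ lookup (lookup F (proj₂ (remQuot {v} c u))) (proj₁ (remQuot {v} c u))
    lookup-assembled F u = trans
      (cong (lookup (concat (transpose F))) (≡.sym (combine-remQuot {v} c u)))
      (trans (lookup-concat (transpose F) _ _) (lookup-transpose F _ _))

    □-cases : ∀ u w → adj (H □ Cₘ) u w ≡ true →
      let (x , i) = remQuot {v} c u ; (y , j) = remQuot {v} c w in
      (adj H x y ≡ true × i ≡ j) ⊎ (cycleAdj c 3≤m i j ≡ true × x ≡ y)
    □-cases u w u~w = split (adj H x y) (cycleAdj c 3≤m i j) (i ≟ᶠ j) (x ≟ᶠ y) u~w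
      where
      x = proj₁ (remQuot {v} c u)
      i = proj₂ (remQuot {v} c u)
      y = proj₁ (remQuot {v} c w)
      j = proj₂ (remQuot {v} c w)
      split : ∀ a b (d : Dec (i ≡ j)) (d′ : Dec (x ≡ y)) → (a ∧ does d) ∨ (b ∧ does d′) ≡ true →
        (a ≡ true × i ≡ j) ⊎ (b ≡ true × x ≡ y)
      split true  b    (yes p) d′      eq = inj₁ (refl , p)
      split true  true (no _)  (yes q) eq = inj₂ (refl , q)
      split true  true (no _)  (no _)  ()
      split true  false (no _) d′      ()
      split false true d       (yes q) eq = inj₂ (refl , q)
      split false true d       (no _)  ()
      split false false d      d′      ()

    closed≡1⇒hom : ∀ F → closed F ≡ 1 → IsHom (H □ Cₘ) G (lookup (concat (transpose F)))
    closed≡1⇒hom F eq u w u~w = trans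
      (cong₂ (adj G) (lookup-assembled F u) (lookup-assembled F w)) (along (□-cases u w u~w))
      where
      x = proj₁ (remQuot {v} c u)
      i = proj₂ (remQuot {v} c u)
      y = proj₁ (remQuot {v} c w)
      j = proj₂ (remQuot {v} c w)
      along : (adj H x y ≡ true × i ≡ j) ⊎ (cycleAdj c 3≤m i j ≡ true × x ≡ y) →
        adj G (lookup (lookup F i) x) (lookup (lookup F j) y) ≡ true
      along (inj₁ (x~y , i≡j)) = subst (λ j → adj G (lookup (lookup F i) x) (lookup (lookup F j) y) ≡ true) i≡j
        (E≡1⇒hom (lookup F i) (closed≡1⇒μ≡1 F eq i) x y x~y)
      along (inj₂ (i~j , x≡y)) = subst (λ y → adj G (lookup (lookup F i) x) (lookup (lookup F j) y) ≡ true) x≡y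
        (either (cycleAdj⇒step c 3≤m i j i~j))
        where
        either : suc (toℕ i) % c ≡ toℕ j ⊎ suc (toℕ j) % c ≡ toℕ i →
          adj G (lookup (lookup F i) x) (lookup (lookup F j) x) ≡ true
        either (inj₁ step) = cross≡1⇒edge (lookup F i) (lookup F j) (closed≡1⇒K≡1 F eq i j step) x
        either (inj₂ step) = trans (Graph.sym G _ _)
          (cross≡1⇒edge (lookup F j) (lookup F i) (closed≡1⇒K≡1 F eq j i step) x)

    closed≤[[hom]] : ∀ F → closed F ≤ [[ isHom? (H □ Cₘ) G (lookup (concat (transpose F))) ]]
    closed≤[[hom]] F with closed-01 (E-01 (edges H)) (cross-01 r (rel-01 S)) F
    ... | inj₁ eq = ≤-trans (≤-reflexive eq) z≤n
    ... | inj₂ eq = ≤-reflexive (trans eq (≡.sym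
      ([[ isHom? (H □ Cₘ) G (lookup (concat (transpose F))) ]]-yes (closed≡1⇒hom F eq))))

  -- The composite of two paths of n + 1 steps is one path of 2 (n + 1) steps, and its closed walks,
  -- of weight 0 or 1, assemble bijectively into vectors on H □ C; those of weight 1 are
  -- homomorphisms.
  cyclic≤homCount : cyclic v (edges H) n S ≤ homCount (H □ Cₘ) G
  cyclic≤homCount = begin
    cyclic v (edges H) n S
      ≡⟨ ∑-cong xs (λ f → cong (E (edges H) r f *_) (≡.sym (path-compose n n f f))) ⟩
    tr (path (suc (n + n)))
      ≡⟨ cong (λ z → tr (path z)) (len n) ⟩
    tr (path c′)
      ≡⟨ tr-path c′ ⟩
    ∑ (vecs c xs) closed
      ≤⟨ ∑-mono (vecs c xs) closed≤[[hom]] ⟩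
    ∑ (vecs c xs) (λ F → [[ isHom? (H □ Cₘ) G (lookup (concat (transpose F))) ]])
      ≡⟨ trans (∑-vecs-concat v c (allFin (∣V∣ G))) (∑-vecs-transpose v c (allFin (∣V∣ G))) ⟨
    ∑ (vecs (v * c) (allFin (∣V∣ G))) (λ h → [[ isHom? (H □ Cₘ) G (lookup h) ]])
      ≡⟨ homCount≡∑ (H □ Cₘ) G ⟨
    homCount (H □ Cₘ) G ∎
    where
    open ≤-Reasoning
    open Kernel (Vec (Fin (∣V∣ G)) v) xs (E (edges H) r) (cross r)
    len : ∀ n → suc (n + n) ≡ n + 1 * suc n
    len = solve-∀

-- The number of edges of a product with a cycle

∑-allFin-suc : ∀ n {φ : Fin (suc n) → ℕ} → ∑ (allFin (suc n)) φ ≡ φ zero + ∑ (allFin n) (φ ∘ suc)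
∑-allFin-suc n {φ} = cong (φ zero +_)
  (trans (cong (λ is → ∑ is φ) (≡.sym (List.map-tabulate id suc))) (∑-map suc (allFin n)))

∑-allFin-+ : ∀ c m {φ : Fin (c + m) → ℕ} →
  ∑ (allFin (c + m)) φ ≡ ∑ (allFin c) (λ i → φ (i ↑ˡ m)) + ∑ (allFin m) (λ i → φ (c ↑ʳ i))
∑-allFin-+ zero    m = refl
∑-allFin-+ (suc c) m {φ} = begin
  ∑ (allFin (suc c + m)) φ
    ≡⟨ ∑-allFin-suc (c + m) ⟩
  φ zero + ∑ (allFin (c + m)) (φ ∘ suc)
    ≡⟨ cong (φ zero +_) (∑-allFin-+ c m) ⟩
  φ zero + (∑ (allFin c) (λ i → φ (suc (i ↑ˡ m))) + ∑ (allFin m) (λ i → φ (suc (c ↑ʳ i))))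
    ≡⟨ +-assoc (φ zero) _ _ ⟨
  (φ zero + ∑ (allFin c) (λ i → φ (suc (i ↑ˡ m)))) + ∑ (allFin m) (λ i → φ (suc (c ↑ʳ i)))
    ≡⟨ cong (_+ ∑ (allFin m) (λ i → φ (suc c ↑ʳ i))) (∑-allFin-suc c) ⟨
  ∑ (allFin (suc c)) (λ i → φ (i ↑ˡ m)) + ∑ (allFin m) (λ i → φ (suc c ↑ʳ i)) ∎
  where open ≡-Reasoning

∑-combine : ∀ v c {φ : Fin (v * c) → ℕ} →
  ∑ (allFin (v * c)) φ ≡ ∑ (allFin v) (λ i → ∑ (allFin c) (λ j → φ (combine i j)))
∑-combine zero    c = refl
∑-combine (suc v) c {φ} = trans (∑-allFin-+ c (v * c)) (trans
  (cong (∑ (allFin c) (λ j → φ (j ↑ˡ (v * c))) +_) (∑-combine v c))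
  (≡.sym (∑-allFin-suc v)))

∑-allFin-lower : ∀ m {φ : Fin m → ℕ} {b} → (∀ i → b ≤ φ i) → m * b ≤ ∑ (allFin m) φ
∑-allFin-lower m {b = b} b≤φ = ≤-trans
  (≤-reflexive (trans (cong (_* b) (≡.sym (List.length-tabulate {n = m} id))) (≡.sym (∑-const (allFin m) b))))
  (∑-mono (allFin m) b≤φ)

bit-∨ : ∀ a b → ¬ (a ≡ true × b ≡ true) → bit (a ∨ b) ≡ bit a + bit b
bit-∨ true  true  ¬both = ⊥-elim (¬both (refl , refl))
bit-∨ true  false ¬both = refl
bit-∨ false b     ¬both = refl

module _ (m : ℕ) (3≤m : 3 ≤ m) .{{_ : NonZero m}} where
  private
    step : Fin m → Fin m → Bool
    step i j = does (suc (toℕ i) % m ≟ toℕ j)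

    wraps : ∀ (i j : Fin m) → suc (toℕ i) % m ≡ toℕ j →
      (suc (toℕ i) ≡ toℕ j) ⊎ (suc (toℕ i) ≡ m × toℕ j ≡ 0)
    wraps i j eq with m≤n⇒m<n∨m≡n (toℕ<n i)
    ... | inj₁ i<m = inj₁ (trans (≡.sym (m<n⇒m%n≡m i<m)) eq)
    ... | inj₂ i≡m = inj₂ (i≡m , trans (≡.sym eq) (trans (cong (_% m) i≡m) (n%n≡0 m)))

    -- Two forward steps return to the start only if m divides 2. Hence the two directions of a
    -- cycle edge are counted separately.
    step-asym : ∀ i j → ¬ (step i j ≡ true × step j i ≡ true)
    step-asym i j (i→j , j→i) with wraps i j (does≡true⇒ (suc (toℕ i) % m ≟ toℕ j) i→j)
                                 | wraps j i (does≡true⇒ (suc (toℕ j) % m ≟ toℕ i) j→i)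
    ... | inj₁ p       | inj₁ q       = <⇒≱ (≤-reflexive p) (≤-trans (n≤1+n _) (≤-reflexive q))
    ... | inj₁ p       | inj₂ (q , z) = <⇒≱ 3≤m (≤-reflexive (trans (≡.sym q) (cong suc (trans (≡.sym p) (cong suc z)))))
    ... | inj₂ (p , z) | inj₁ q       = <⇒≱ 3≤m (≤-reflexive (trans (≡.sym p) (cong suc (trans (≡.sym q) (cong suc z)))))
    ... | inj₂ (p , z) | inj₂ (q , _) = <⇒≱ (≤-trans (s≤s (s≤s z≤n)) 3≤m) (≤-reflexive (trans (≡.sym q) (cong suc z)))

    one-step : ∀ i → 1 ≤ ∑ (allFin m) (λ j → bit (step i j))
    one-step i = ≤-trans
      (≤-reflexive (≡.sym (cong bit (dec-true (suc (toℕ i) % m ≟ toℕ j) (≡.sym (toℕ-fromℕ< (m%n<n (suc (toℕ i)) m)))))))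
      (∑-∈-≤ {f = λ j → bit (step i j)} (∈-allFin j))
      where j = fromℕ< (m%n<n (suc (toℕ i)) m)

  arcs-cycle : 2 * m ≤ arcs (toListGraph (cycleGraph m 3≤m))
  arcs-cycle = begin
    2 * m                                ≡⟨ cong₂ (λ x y → x + (y + 0)) (*-identityʳ m) (*-identityʳ m) ⟨
    m * 1 + (m * 1 + 0)                  ≡⟨ cong (m * 1 +_) (+-identityʳ (m * 1)) ⟩
    m * 1 + m * 1                        ≤⟨ +-mono-≤ (∑-allFin-lower m one-step) (∑-allFin-lower m one-step) ⟩
    S + S                                ≡⟨ cong (S +_) (∑-swap V V) ⟩
    S + ∑ V (λ i → ∑ V (λ j → bit (step j i)))
                                         ≡⟨ trans (∑-cong V (λ i → ∑-+ V)) (∑-+ V) ⟨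
    ∑ V (λ i → ∑ V (λ j → bit (step i j) + bit (step j i)))
                                         ≡⟨ ∑-cong V (λ i → ∑-cong V (λ j → bit-∨ (step i j) (step j i) (step-asym i j))) ⟨
    arcs (toListGraph (cycleGraph m 3≤m)) ∎
    where
    open ≤-Reasoning
    V = allFin m
    S = ∑ V (λ i → ∑ V (λ j → bit (step i j)))

module _ (H K : Graph) where
  private
    v  = ∣V∣ H
    c  = ∣V∣ K
    V  = allFin v
    W  = allFin c
    rH = rel (toListGraph H)
    rK = rel (toListGraph K)

    δ : ∀ {m} → Fin m → Fin m → ℕ
    δ i j = bit (does (i ≟ᶠ j))

    ∑δ : ∀ m → m ≤ ∑ (allFin m) (λ i → ∑ (allFin m) (δ i))
    ∑δ m = ≤-trans (≤-reflexive (≡.sym (*-identityʳ m))) (∑-allFin-lower m (λ i → ≤-trans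
      (≤-reflexive (≡.sym (cong bit (dec-true (i ≟ᶠ i) refl)))) (∑-∈-≤ {f = δ i} (∈-allFin i))))

    -- The two kinds of edges exclude each other: i ≠ j rules out the first, and i = j the second
    -- since `K` has no loops. So their indicators may be added.
    □-rel : ∀ x i y j → rH x y * δ i j + δ x y * rK i j ≤ bit (adj (H □ K) (combine x i) (combine y j))
    □-rel x i y j = ≤-trans (split (i ≟ᶠ j)) (≤-reflexive (cong₂ formula (≡.sym (remQuot-combine x i)) (≡.sym (remQuot-combine y j))))
      where
      formula : Fin v × Fin c → Fin v × Fin c → ℕ
      formula (x , i) (y , j) = bit ((adj H x y ∧ does (i ≟ᶠ j)) ∨ (adj K i j ∧ does (x ≟ᶠ y)))
      same : ∀ a b → bit a * 1 + bit b * 0 ≤ bit ((a ∧ true) ∨ (false ∧ b))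
      same true  b = ≤-reflexive (cong (1 +_) (*-zeroʳ (bit b)))
      same false b = ≤-reflexive (*-zeroʳ (bit b))
      different : ∀ a b b′ → bit a * 0 + bit b′ * bit b ≤ bit ((a ∧ false) ∨ (b ∧ b′))
      different true  true  true  = ≤-refl
      different true  true  false = ≤-refl
      different true  false true  = ≤-refl
      different true  false false = ≤-refl
      different false true  true  = ≤-refl
      different false true  false = ≤-refl
      different false false true  = ≤-refl
      different false false false = ≤-refl
      split : (d : Dec (i ≡ j)) → rH x y * bit (does d) + δ x y * rK i j
        ≤ bit ((adj H x y ∧ does d) ∨ (adj K i j ∧ does (x ≟ᶠ y)))
      split (yes refl) = subst
        (λ b → rH x y * 1 + δ x y * bit b ≤ bit ((adj H x y ∧ true) ∨ (b ∧ does (x ≟ᶠ y))))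
        (≡.sym (Graph.irrefl K i)) (same (adj H x y) (does (x ≟ᶠ y)))
      split (no _) = different (adj H x y) (adj K i j) (does (x ≟ᶠ y))

  arcs-□ : arcs (toListGraph H) * c + v * arcs (toListGraph K) ≤ arcs (toListGraph (H □ K))
  arcs-□ = begin
    arcs (toListGraph H) * c + v * arcs (toListGraph K)
      ≤⟨ +-mono-≤ (*-monoʳ-≤ (arcs (toListGraph H)) (∑δ c)) (*-monoˡ-≤ (arcs (toListGraph K)) (∑δ v)) ⟩
    arcs (toListGraph H) * ∑ W (λ i → ∑ W (δ i)) + ∑ V (λ x → ∑ V (δ x)) * arcs (toListGraph K)
      ≡⟨ cong₂ _+_ (product rH δ) (product δ rK) ⟩
    ∑ V (λ x → ∑ W (λ i → ∑ V (λ y → ∑ W (λ j → rH x y * δ i j))))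
      + ∑ V (λ x → ∑ W (λ i → ∑ V (λ y → ∑ W (λ j → δ x y * rK i j))))
      ≡⟨ trans (∑-cong V (λ x → trans (∑-cong W (λ i → trans (∑-cong V (λ y → ∑-+ W)) (∑-+ V))) (∑-+ W))) (∑-+ V) ⟨
    ∑ V (λ x → ∑ W (λ i → ∑ V (λ y → ∑ W (λ j → rH x y * δ i j + δ x y * rK i j))))
      ≤⟨ ∑-mono V (λ x → ∑-mono W (λ i → ∑-mono V (λ y → ∑-mono W (λ j → □-rel x i y j)))) ⟩
    ∑ V (λ x → ∑ W (λ i → ∑ V (λ y → ∑ W (λ j → bit (adj (H □ K) (combine x i) (combine y j))))))
      ≡⟨ trans (∑-combine v c) (∑-cong V (λ x → ∑-cong W (λ i → ∑-combine v c))) ⟨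
    arcs (toListGraph (H □ K)) ∎
    where
    open ≤-Reasoning
    product : ∀ (r : Fin v → Fin v → ℕ) (s : Fin c → Fin c → ℕ) →
      ∑ V (λ x → ∑ V (r x)) * ∑ W (λ i → ∑ W (s i))
        ≡ ∑ V (λ x → ∑ W (λ i → ∑ V (λ y → ∑ W (λ j → r x y * s i j))))
    product r s = trans (≡.sym (∑-* V W)) (∑-cong V (λ x → ∑-cong W (λ i → ≡.sym (∑-* V W))))

-- A lower bound for the edge number is the useful direction: since 2|E(G)| ≤ |V(G)|², Sidorenko's
-- inequality with a smaller exponent implies the one with a larger exponent.
∣E∣-□-cycle : ∀ H m (3≤m : 3 ≤ m) → (∣V∣ H + ∣E∣ H) * m ≤ ∣E∣ (H □ cycleGraph m 3≤m)
∣E∣-□-cycle H m 3≤m = *-cancelˡ-≤ 2 (begin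
  2 * ((v + e) * m)                                ≡⟨ eq v e m ⟩
  (2 * e) * m + v * (2 * m)                        ≡⟨ cong (λ z → z * m + v * (2 * m)) (2∣E∣≡arcs H) ⟩
  arcs (toListGraph H) * m + v * (2 * m)           ≤⟨ +-monoʳ-≤ _ (*-monoʳ-≤ v (arcs-cycle m 3≤m {{>-nonZero (≤-trans (s≤s z≤n) 3≤m)}})) ⟩
  arcs (toListGraph H) * m + v * arcs (toListGraph (cycleGraph m 3≤m)) ≤⟨ arcs-□ H (cycleGraph m 3≤m) ⟩
  arcs (toListGraph (H □ cycleGraph m 3≤m))        ≡⟨ 2∣E∣≡arcs (H □ cycleGraph m 3≤m) ⟨
  2 * ∣E∣ (H □ cycleGraph m 3≤m)                   ∎)
  where
  open ≤-Reasoning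
  v = ∣V∣ H
  e = ∣E∣ H
  eq : ∀ v e m → 2 * ((v + e) * m) ≡ (2 * e) * m + v * (2 * m)
  eq = solve-∀

homCount-empty : ∀ H G → ∣V∣ H ≡ 0 → 1 ≤ homCount H G
homCount-empty H@record { n = zero } G refl = ≤-reflexive (≡.sym (trans (homCount≡∑ H G)
  (trans (+-identityʳ _) ([[ isHom? H G (lookup []) ]]-yes (λ ())))))

sidorenko-□-cycle : ∀ H → Sidorenko H → ∀ n (3≤m : 3 ≤ 2 * suc n) → Sidorenko (H □ cycleGraph (2 * suc n) 3≤m)
sidorenko-□-cycle H sid n 3≤m G 1≤N with arcs (toListGraph G) in arcs≡
... | zero  = begin
  N ^ (v * c) * (2 * ∣E∣ G) ^ E′     ≡⟨ cong (λ z → N ^ (v * c) * z ^ E′) (trans (2∣E∣≡arcs G) arcs≡) ⟩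
  N ^ (v * c) * 0 ^ E′               ≤⟨ edgeless E′ (∣E∣-□-cycle H c 3≤m) ⟩
  homCount HC G * N ^ (2 * E′)       ∎
  where
  open ≤-Reasoning
  N  = ∣V∣ G
  v  = ∣V∣ H
  e  = ∣E∣ H
  c  = 2 * suc n
  HC = H □ cycleGraph c 3≤m
  E′ = ∣E∣ HC
  edgeless : ∀ E′ → (v + e) * c ≤ E′ → N ^ (v * c) * 0 ^ E′ ≤ homCount HC G * N ^ (2 * E′)
  edgeless (suc E′) _ = ≤-trans (≤-reflexive (*-zeroʳ (N ^ (v * c)))) z≤n
  -- Here 0 ^ 0 = 1, so the left side need not vanish. But no edges in the product forces v c = 0;
  -- then the left side is 1, and the empty map is a homomorphism.
  edgeless zero     le = ≤-trans (≤-reflexive (cong (λ z → N ^ z * 1) vc≡0))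
    (≤-trans (homCount-empty HC G vc≡0) (≤-reflexive (≡.sym (*-identityʳ _))))
    where
    vc≡0 : v * c ≡ 0
    vc≡0 = n≤0⇒n≡0 (≤-trans (*-monoˡ-≤ c (m≤m+n v e)) le)
... | suc _ = begin
  N ^ (v * c) * (2 * ∣E∣ G) ^ E′
    ≡⟨ cong₂ (λ z w → N ^ (v * c) * z ^ w) (2∣E∣≡arcs G) (≡.sym (m+[n∸m]≡n E₀≤E′)) ⟩
  N ^ (v * c) * D ^ (E₀ + d)
    ≡⟨ cong (N ^ (v * c) *_) (^-distribˡ-+-* D E₀ d) ⟩
  N ^ (v * c) * (D ^ E₀ * D ^ d)
    ≡⟨ *-assoc (N ^ (v * c)) _ _ ⟨
  (N ^ (v * c) * D ^ E₀) * D ^ d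
    -- Each of the `d` edges beyond `E₀` brings a factor `D` on the left and N² on the right.
    ≤⟨ *-mono-≤ core (^-monoˡ-≤ d D≤N²) ⟩
  (homCount HC G * N ^ (2 * E₀)) * (N * N) ^ d
    ≡⟨ trans (*-assoc (homCount HC G) _ _) (cong (homCount HC G *_) powers) ⟩
  homCount HC G * N ^ (2 * E′) ∎
  where
  open ≤-Reasoning
  N  = ∣V∣ G
  v  = ∣V∣ H
  e  = ∣E∣ H
  c  = 2 * suc n
  HC = H □ cycleGraph c 3≤m
  E′ = ∣E∣ HC
  E₀ = (v + e) * c
  D  = arcs (toListGraph G)
  a  = cyclic v (edges H) n (toListGraph G)
  E₀≤E′ : E₀ ≤ E′
  E₀≤E′ = ∣E∣-□-cycle H c 3≤m
  d = E′ ∸ E₀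
  D≤N² : D ≤ N * N
  D≤N² = subst (λ z → D ≤ z * z) (order-toListGraph G) (arcs≤order² (toListGraph G))
  powers : N ^ (2 * E₀) * (N * N) ^ d ≡ N ^ (2 * E′)
  powers = trans (cong (λ z → N ^ (2 * E₀) * z) (trans (cong (λ z → (N * z) ^ d) (≡.sym (*-identityʳ N))) (^-*-assoc N 2 d)))
    (trans (≡.sym (^-distribˡ-+-* N (2 * E₀) (2 * d)))
      (cong (N ^_) (trans (≡.sym (*-distribˡ-+ 2 E₀ d)) (cong (2 *_) (m+[n∸m]≡n E₀≤E′)))))
  1≤D : 1 ≤ D
  1≤D = ≤-trans (s≤s z≤n) (≤-reflexive (≡.sym arcs≡))
  limit : (D ^ v * D ^ e) ^ c ≤ a * (N ^ v * (N ^ 2) ^ e) ^ c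
  limit = subst (λ z → (D ^ v * D ^ e) ^ c ≤ a * (z ^ v * (z ^ 2) ^ e) ^ c) (order-toListGraph G)
    (cyclic-sidorenko {∣V∣ H} {edges H} (sidorenkoOnLists H sid) (toListGraph G) n 1≤D)
  exponents : ∀ v e c → v * c + (v + 2 * e) * c ≡ 2 * ((v + e) * c)
  exponents = solve-∀
  -- `limit` multiplied by N^(v c); on the right the exponents of N add up to v c + (v + 2e) c = 2
  -- (v + e) c.
  core : N ^ (v * c) * D ^ E₀ ≤ homCount HC G * N ^ (2 * E₀)
  core = begin
    N ^ (v * c) * D ^ E₀
      ≡⟨ cong (N ^ (v * c) *_) (trans (≡.sym (^-*-assoc D (v + e) c)) (cong (_^ c) (^-distribˡ-+-* D v e))) ⟩
    N ^ (v * c) * (D ^ v * D ^ e) ^ c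
      ≤⟨ *-monoʳ-≤ (N ^ (v * c)) (≤-trans limit (*-monoˡ-≤ _ (cyclic≤homCount H G n 3≤m))) ⟩
    N ^ (v * c) * (homCount HC G * (N ^ v * (N ^ 2) ^ e) ^ c)
      ≡⟨ cong (λ z → N ^ (v * c) * (homCount HC G * z)) (trans
           (cong (_^ c) (trans (cong (N ^ v *_) (^-*-assoc N 2 e)) (≡.sym (^-distribˡ-+-* N v (2 * e)))))
           (^-*-assoc N (v + 2 * e) c)) ⟩
    N ^ (v * c) * (homCount HC G * N ^ ((v + 2 * e) * c))
      ≡⟨ swap-factors (N ^ (v * c)) (homCount HC G) _ ⟩
    homCount HC G * (N ^ (v * c) * N ^ ((v + 2 * e) * c))
      ≡⟨ cong (homCount HC G *_) (trans (≡.sym (^-distribˡ-+-* N (v * c) ((v + 2 * e) * c))) (cong (N ^_) (exponents v e c))) ⟩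
    homCount HC G * N ^ (2 * E₀) ∎
    where
    swap-factors : ∀ a b c → a * (b * c) ≡ b * (a * c)
    swap-factors = solve-∀

theorem1p4 : ∀ (k : ℕ) (2≤k : 2 ≤ k) (H : Graph) →
    Sidorenko H → Sidorenko (H □ C[2* k ] 2≤k)
theorem1p4 (suc n) 2≤k H sid =
  -- The proof of `3 ≤ 2 * k` is the one built into `C[2*_]`, so that both cycle graphs agree
  -- definitionally.
  sidorenko-□-cycle H sid n (≤-trans (s≤s (s≤s (s≤s z≤n))) (*-monoʳ-≤ 2 2≤k))
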